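{- Fix an integer $r\ge 3$ and a real $C$, and for each $n$ let $D(n)$ denote the maximum of $d_C(\mathcal{F})$ over all intersecting families $\mathcal{F}\subseteq\binom{[n]}{r}$. If $q<r$ is a positive integer with $\frac{q^2+q+1}{q+1}\le C$, then $D(n)=O(n^{r-q-1})$ as $n\to\infty$. Furthermore, if there exists a prime power $p<r$ with $C<\frac{p^2+p+1}{p+1}$, then $D(n)=\Omega(n^{r-p-1})$ as $n\to\infty$.
   Context: $\binom{[n]}{r}$ is the set of $r$-element subsets of $[n]$. A family is intersecting if every two members intersect. $\Delta(\mathcal{F})$ is the maximum over vertices $x$ of the number of members of $\mathcal{F}$ containing $x$, and the $C$-weighted diversity is $d_C(\mathcal{F}):=|\mathcal{F}|-C\cdot\Delta(\mathcal{F})$. Asymptotic notation is with $r$, $C$, $q$, $p$ fixed and $n\to\infty$.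
   Formalization: The weight C is taken to be a rational number instead of a real one; the real case follows because the C-weighted diversity decreases in C and the thresholds are rational. -}

module Defs where

open import Data.Nat as ℕ using (ℕ; suc; _+_; _*_; _^_; _≤_; _<_; _⊔_)
open import Data.Nat.Primality using (Prime)
open import Data.Fin using (Fin)
open import Data.Fin.Subset using (Subset; _∩_; ∣_∣; Nonempty)
open import Data.Fin.Subset.Properties using (_∈?_)
open import Data.List using (List; length; filter; map; foldr; allFin)
open import Data.List.Relation.Unary.All using (All)
open import Data.List.Relation.Unary.Unique.Propositional using (Unique)
open import Data.List.Membership.Propositional using (_∈_)
open import Data.Integer using (+_)
open import Data.Rational as ℚ using (ℚ)
open import Data.Product using (Σ; ∃; _×_)
open import Relation.Binary.PropositionalEquality using (_≡_)

record Family (n r : ℕ) : Set where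
  field
    members  : List (Subset n)
    distinct : Unique members
    uniform  : All (λ A → ∣ A ∣ ≡ r) members
open Family public

size : ∀ {n r} → Family n r → ℕ
size F = length (members F)

Intersecting : ∀ {n r} → Family n r → Set
Intersecting F = ∀ {A B} → A ∈ members F → B ∈ members F → Nonempty (A ∩ B)

degree : ∀ {n r} → Family n r → Fin n → ℕ
degree F x = length (filter (x ∈?_) (members F))

Δ : ∀ {n r} → Family n r → ℕ
Δ {n} F = foldr _⊔_ 0 (map (degree F) (allFin n))

ℕ→ℚ : ℕ → ℚ
ℕ→ℚ k = (+ k) ℚ./ 1

d : ℚ → ∀ {n r} → Family n r → ℚ
d C F = ℕ→ℚ (size F) ℚ.- C ℚ.* ℕ→ℚ (Δ F)

threshold : ℕ → ℚ
threshold q = (+ (q * q + q + 1)) ℚ./ suc q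

IsPrimePower : ℕ → Set
IsPrimePower p = Σ ℕ λ ℓ → Σ ℕ λ k → Prime ℓ × 1 ≤ k × p ≡ ℓ ^ k

DIsBigO : ℚ → ℕ → ℕ → Set
DIsBigO C r e = Σ ℚ λ K → Σ ℕ λ N → ∀ n → N ≤ n →
  (F : Family n r) → Intersecting F → d C F ℚ.≤ K ℚ.* ℕ→ℚ (n ^ e)

DIsBigΩ : ℚ → ℕ → ℕ → Set
DIsBigΩ C r e = Σ ℚ λ c → ℚ.0ℚ ℚ.< c × Σ ℕ λ N → ∀ n → N ≤ n →
  Σ (Family n r) λ F → Intersecting F × c ℚ.* ℕ→ℚ (n ^ e) ℚ.≤ d C F

{-# OPTIONS --safe #-}

-- Upper bound.  The threshold exceeds q, so q ≤ C.  If some set X with at most q elements meets every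
-- member of F then |F| ≤ q Δ(F) ≤ C Δ(F).  Otherwise branching over the points of members missed so far shows
-- that every member contains one of at most r ^ (q + 1) sets with q + 1 points, each of which lies in at most
-- n ^ (r ∸ q ∸ 1) members.
--
-- Lower bound.  Complete the lines of a projective plane of order p on a fixed set of points to r-sets by
-- transversals of r ∸ p ∸ 1 disjoint blocks, each with about n / (r ∸ p) points.  A point of the plane lies in the
-- fraction (p + 1) / (p² + p + 1) of these r-sets, and for large n the other points have smaller degree.
--
-- The plane is coordinatised by a field with q = ℓ ^ k elements.  In 𝔽ℓ[T] / (T ^ q − T) every element satisfies
-- x ^ q = x, and h = ∏ (T ^ (ℓ ^ d) − T) over 0 < d < k is not zero because its degree is less than q.  In a residue
-- field where h is invertible the k conjugates T ^ (ℓ ^ j) are distinct, so 1, T, …, T ^ (k − 1) are linearly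
-- independent and there are at least q elements; there are at most q since all are roots of X ^ q − X.

module Submission where

open import Defs
open import Algebra.Bundles using (CommutativeRing)
import Algebra.Properties.CommutativeSemiring.Binomial as Binomial
import Algebra.Properties.CommutativeSemiring.Exp as Exponentiation
import Algebra.Properties.Ring as RingProperties
import Algebra.Properties.Semiring.Mult as Multiplication
import Algebra.Properties.Semiring.Sum as Summation
open import Algebra.Structures using (IsCommutativeRing)
open import Data.Empty using (⊥; ⊥-elim)
open import Data.Fin as Fin using (Fin; zero; suc; toℕ; fromℕ; fromℕ<; inject₁; _↑ˡ_; _↑ʳ_; combine; finToFun; funToFin)
import Data.Fin.Properties as Fin
open import Data.Fin.Subset as Subset using (Subset)
import Data.Fin.Subset.Properties as Subset
open import Data.Fin.Subset.Properties using (_∈?_; _⊆?_; nonempty?)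
import Data.Integer as ℤ
import Data.Integer.Properties as ℤ
open import Data.List as List using (List; []; _∷_; length; filter; map; foldr; upTo; allFin; cartesianProductWith)
import Data.List.Membership.Propositional as ListMem
import Data.List.Membership.Propositional.Properties as ListMem
import Data.List.Properties as List
open import Data.List.Relation.Unary.All as All using (All; []; _∷_)
import Data.List.Relation.Unary.All.Properties as All
open import Data.List.Relation.Unary.AllPairs using ([]; _∷_)
open import Data.List.Relation.Unary.Any as Any using (Any; here; there)
open import Data.List.Relation.Unary.Unique.Propositional using (Unique)
import Data.List.Relation.Unary.Unique.Propositional.Properties as Unique
open import Data.Nat as ℕ using (ℕ; zero; suc; _∸_; _!; _≤_; _<_; z≤n; s≤s; _≟_; NonZero)
open import Data.Nat.Combinatorics using (nCk≡n!/k![n-k]!; k![n∸k]!∣n!; nCn≡1) renaming (_C_ to _choose_)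
open import Data.Nat.Coprimality using (prime⇒coprime; coprime-Bézout)
open import Data.Nat.Divisibility using (_∣_; divides; ∣⇒≤; m∣m*n)
open import Data.Nat.DivMod
open import Data.Nat.GCD using (module Bézout)
open import Data.Nat.Primality using (Prime; euclidsLemma; prime⇒nonTrivial; ¬prime[0]; ¬prime[1])
import Data.Nat.Properties as ℕ
open import Data.Product using (Σ; ∃; _×_; _,_; proj₁; proj₂)
open import Data.Rational as ℚ using (ℚ; fromℚᵘ)
import Data.Rational.Properties as ℚ
open import Data.Rational.Unnormalised as ℚᵘ using (mkℚᵘ; *≡*; *≤*)
import Data.Rational.Unnormalised.Properties as ℚᵘ
open import Data.Sum as Sum using (_⊎_; inj₁; inj₂; [_,_]′)
open import Data.Unit using (⊤; tt)
open import Data.Vec using ([]; _∷_; here; there)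
import Data.Vec.Properties as Vec
open import Function using (_∘_; id)
open import Level using (0ℓ)
open import Relation.Binary.Core using (Rel)
open import Relation.Binary.Definitions using (tri<; tri≈; tri>) renaming (Decidable to Decidable₂)
open import Relation.Binary.PropositionalEquality as ≡ using (_≡_; _≢_)
import Relation.Binary.Reasoning.Setoid as SetoidReasoning
open import Relation.Nullary using (¬_; yes; no; ¬?; decidable-stable)
open import Relation.Nullary.Decidable as Dec using (_×-dec_)
open import Relation.Unary using (Decidable)

-- Roots of polynomials and fields of prime power order

-- The main obstacle is a field with `ℓ ^ k` elements. It is not built from a chosen irreducible
-- polynomial of degree `k`; it is found as a residue field of a finite ring, whose elements can be
-- treated one after another: each becomes zero or is already a unit. A careless choice may end in a
-- field that is too small, for instance 𝔽ℓ itself when `T` is sent to 0. The choice is steered by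
-- an idempotent. Since every element satisfies `x ^ q = x`, the power `e = h ^ (q − 1)` satisfies
-- `h e = h`. Dividing by `1 − e` first leaves a nonzero ring, because `h` is nonzero, and there
-- `e = 1`, so `h` is a unit in every further nonzero quotient. The plane sees the field only
-- through the operation `m x + b` and two of its properties, so fields and geometry stay separate.
-- In the lower bound the ratio of the number of sets to the bound on the degree is exactly the
-- threshold. Any `C` below it therefore leaves a fixed positive proportion of the sets.

prime∤! : ∀ {p} → Prime p → ∀ m → m ℕ.< p → ¬ p ∣ m !
prime∤! pr zero    _   p∣1 = ℕ.<⇒≱ (ℕ.nonTrivial⇒n>1 _ {{prime⇒nonTrivial pr}}) (∣⇒≤ p∣1)
prime∤! pr (suc m) m<p p∣! with euclidsLemma (suc m) (m !) pr p∣!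
... | inj₁ p∣m  = ℕ.<⇒≱ m<p (∣⇒≤ p∣m)
... | inj₂ p∣m! = prime∤! pr m (ℕ.<-trans (ℕ.n<1+n m) m<p) p∣m!

-- `p` divides `p !`, which is the binomial coefficient times two factorials of numbers below `p`,
-- and it divides neither of these.
prime∣choose : ∀ {p} → Prime p → ∀ k → 1 ℕ.≤ k → k ℕ.< p → p ∣ p choose k
prime∣choose {zero}  pr = ⊥-elim (¬prime[0] pr)
prime∣choose {p@(suc p-1)} pr k 1≤k k<p =
  [ id
  , (λ h → ⊥-elim ([ prime∤! pr k k<p
                   , prime∤! pr (p ∸ k) (ℕ.∸-monoʳ-< 1≤k (ℕ.<⇒≤ k<p)) ]′
                   (euclidsLemma (k !) ((p ∸ k) !) pr h))) ]′
  (euclidsLemma (p choose k) (k ! ℕ.* (p ∸ k) !) pr (≡.subst (p ∣_) (≡.sym C*) (m∣m*n (p-1 !))))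
  where
  instance _ = k ℕ.!* (p ∸ k) !≢0
  C* : (p choose k) ℕ.* (k ! ℕ.* (p ∸ k) !) ≡ p !
  C* = ≡.trans (≡.cong (ℕ._* (k ! ℕ.* (p ∸ k) !)) (nCk≡n!/k![n-k]! {p} {k} (ℕ.<⇒≤ k<p)))
               (m/n*n≡m (k![n∸k]!∣n! {p} {k} (ℕ.<⇒≤ k<p)))

module Frobenius {c e} (R : CommutativeRing c e) (p : ℕ) (pr : Prime p)
  (p×1≈0 : CommutativeRing._≈_ R (Multiplication._×_ (CommutativeRing.semiring R) p (CommutativeRing.1# R))
                                 (CommutativeRing.0# R)) where

  open CommutativeRing R hiding (zero)
  open Multiplication semiring renaming (_×_ to _⊠_)
  open Summation semiring using (sum; sum-cong-≋; sum-init-last; sum-replicate-zero)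
  open Exponentiation commutativeSemiring
  open import Relation.Binary.Reasoning.Setoid setoid

  p∣⇒×≈0 : ∀ {m} → p ∣ m → ∀ x → m ⊠ x ≈ 0#
  p∣⇒×≈0 {m} (divides q ≡.refl) x = begin
    (q ℕ.* p) ⊠ x        ≈⟨ ×-assocˡ x q p ⟨
    q ⊠ (p ⊠ x)          ≈⟨ ×-congʳ q (×-congʳ p (*-identityˡ x)) ⟨
    q ⊠ (p ⊠ (1# * x))   ≈⟨ ×-congʳ q (×-assoc-* p 1# x) ⟨
    q ⊠ ((p ⊠ 1#) * x)   ≈⟨ ×-congʳ q (trans (*-congʳ p×1≈0) (zeroˡ x)) ⟩
    q ⊠ 0#               ≈⟨ ×-congʳ q (zeroˡ 0#) ⟨
    q ⊠ (0# * 0#)        ≈⟨ ×-comm-* q 0# 0# ⟨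
    0# * (q ⊠ 0#)        ≈⟨ zeroˡ _ ⟩
    0#                   ∎

  ^p-distrib-+ : ∀ x y → (x + y) ^ p ≈ x ^ p + y ^ p
  ^p-distrib-+ x y = expand p ≡.refl
    where
    open Binomial commutativeSemiring using (theorem; binomialTerm)
    -- The exponent is generalised to an `n` equal to `p` so that it can be matched as
    -- `suc (suc m)`; this separates the first and last terms of the binomial sum from the middle
    -- ones, whose coefficients are multiples of `p`.
    expand : ∀ n → n ≡ p → (x + y) ^ n ≈ x ^ n + y ^ n
    expand zero          ≡.refl = ⊥-elim (¬prime[0] pr)
    expand (suc zero)    ≡.refl = ⊥-elim (¬prime[1] pr)
    expand (suc (suc m)) ≡.refl = begin
      (x + y) ^ n                     ≈⟨ theorem n x y ⟩
      t zero + sum (λ i → t (suc i))  ≈⟨ +-cong first (trans (sum-init-last (λ i → t (suc i)))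
                                          (+-cong (trans (sum-cong-≋ middle) (sum-replicate-zero (suc m))) last)) ⟩
      y ^ n + (0# + x ^ n)            ≈⟨ +-congˡ (+-identityˡ _) ⟩
      y ^ n + x ^ n                   ≈⟨ +-comm _ _ ⟩
      x ^ n + y ^ n                   ∎
      where
      n = suc (suc m)
      t = binomialTerm x y n
      first : t zero ≈ y ^ n
      first = trans (+-identityʳ _) (*-identityˡ _)
      middle : ∀ i → t (suc (inject₁ i)) ≈ 0#
      middle i = p∣⇒×≈0 (prime∣choose pr _ (s≤s z≤n)
        (s≤s (≡.subst (ℕ._< suc m) (≡.sym (Fin.toℕ-inject₁ i)) (Fin.toℕ<n i)))) _
      last : t (suc (fromℕ (suc m))) ≈ x ^ n
      last rewrite Fin.toℕ-fromℕ m | nCn≡1 n | ℕ.n∸n≡0 m =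
        trans (+-identityʳ _) (*-identityʳ _)

  ^pʲ-distrib-+ : ∀ j x y → (x + y) ^ (p ℕ.^ j) ≈ x ^ (p ℕ.^ j) + y ^ (p ℕ.^ j)
  ^pʲ-distrib-+ zero    x y = trans (*-identityʳ _) (sym (+-cong (*-identityʳ x) (*-identityʳ y)))
  ^pʲ-distrib-+ (suc j) x y = begin
    (x + y) ^ (p ℕ.* p ℕ.^ j)             ≈⟨ ^-assocʳ (x + y) p (p ℕ.^ j) ⟨
    ((x + y) ^ p) ^ (p ℕ.^ j)             ≈⟨ ^-congˡ (p ℕ.^ j) (^p-distrib-+ x y) ⟩
    (x ^ p + y ^ p) ^ (p ℕ.^ j)           ≈⟨ ^pʲ-distrib-+ j _ _ ⟩
    (x ^ p) ^ (p ℕ.^ j) + (y ^ p) ^ (p ℕ.^ j)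
                                          ≈⟨ +-cong (^-assocʳ x p (p ℕ.^ j)) (^-assocʳ y p (p ℕ.^ j)) ⟩
    x ^ (p ℕ.* p ℕ.^ j) + y ^ (p ℕ.* p ℕ.^ j) ∎

module Polynomial {c e} (R : CommutativeRing c e) where

  open CommutativeRing R hiding (zero)
  open import Relation.Binary.Reasoning.Setoid setoid

  x≈y+[x-y] : ∀ x y → x ≈ y + (x - y)
  x≈y+[x-y] x y = sym (trans (+-comm y _) (trans (+-assoc x _ y)
                     (trans (+-congˡ (-‿inverseˡ y)) (+-identityʳ x))))

  -- The leading coefficient `u` is kept apart from the lower ones, so that the degree is exactly
  -- `n` as soon as `u` is nonzero.
  poly : ∀ {n} → Carrier → (Fin n → Carrier) → Carrier → Carrier
  poly {zero}  u cs x = u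
  poly {suc n} u cs x = cs zero + x * poly u (cs ∘ suc) x

  -- Synthetic division by X - a: the coefficients are the Horner values at `a` of the tails of
  -- `cs`. The leading coefficient is again `u`.
  quotient : ∀ {n} → Carrier → (Fin (suc n) → Carrier) → Carrier → Fin n → Carrier
  quotient u cs a zero    = poly u (cs ∘ suc) a
  quotient u cs a (suc i) = quotient u (cs ∘ suc) a i

  poly-quotient : ∀ {n} u (cs : Fin (suc n) → Carrier) {x a d} → x ≈ a + d →
                  poly u cs x ≈ poly u cs a + d * poly u (quotient u cs a) x
  poly-quotient {zero} u cs {x} {a} {d} x≈a+d = begin
    cs zero + x * u           ≈⟨ +-congˡ (trans (*-congʳ x≈a+d) (distribʳ u a d)) ⟩
    cs zero + (a * u + d * u) ≈⟨ +-assoc _ _ _ ⟨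
    (cs zero + a * u) + d * u ∎
  poly-quotient {suc n} u cs {x} {a} {d} x≈a+d = begin
    c₀ + x * Px                        ≈⟨ +-congˡ (*-congˡ (poly-quotient u (cs ∘ suc) x≈a+d)) ⟩
    c₀ + x * (Pa + d * Q)              ≈⟨ +-congˡ (distribˡ x Pa (d * Q)) ⟩
    c₀ + (x * Pa + x * (d * Q))        ≈⟨ +-congˡ (+-cong (trans (*-congʳ x≈a+d) (distribʳ Pa a d)) x∙dQ) ⟩
    c₀ + ((a * Pa + d * Pa) + d * (x * Q)) ≈⟨ +-congˡ (trans (+-assoc _ _ _) (+-congˡ (sym (distribˡ d Pa (x * Q))))) ⟩
    c₀ + (a * Pa + d * (Pa + x * Q))   ≈⟨ +-assoc _ _ _ ⟨
    (c₀ + a * Pa) + d * (Pa + x * Q)   ∎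
    where
    c₀ = cs zero
    Px = poly u (cs ∘ suc) x
    Pa = poly u (cs ∘ suc) a
    Q  = poly u (quotient u (cs ∘ suc) a) x
    x∙dQ : x * (d * Q) ≈ d * (x * Q)
    x∙dQ = trans (sym (*-assoc x d Q)) (trans (*-congʳ (*-comm x d)) (*-assoc d x Q))

  Distinct : ∀ {n} → (Fin n → Carrier) → Set e
  Distinct f = ∀ {i j} → f i ≈ f j → i ≡ j

  module Roots (integral : ∀ {x y} → x * y ≈ 0# → x ≈ 0# ⊎ y ≈ 0#) where

    -- Divide by the linear factor of the first root. In an integral domain the other roots, being
    -- different from it, are roots of the quotient, whose leading coefficient is still nonzero.
    roots≤degree : ∀ {n d} {u} (cs : Fin d → Carrier) → ¬ u ≈ 0# →
                   (f : Fin n → Carrier) → Distinct f → (∀ i → poly u cs (f i) ≈ 0#) → n ℕ.≤ d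
    roots≤degree {zero}  cs u≉0 f dist root = z≤n
    roots≤degree {suc n} {zero}  cs u≉0 f dist root = ⊥-elim (u≉0 (root zero))
    roots≤degree {suc n} {suc d} {u} cs u≉0 f dist root =
      s≤s (roots≤degree (quotient u cs a) u≉0 (f ∘ suc) (λ eq → suc-injective (dist eq)) root′)
      where
      a = f zero
      suc-injective : ∀ {m} {i j : Fin m} → suc i ≡ suc j → i ≡ j
      suc-injective ≡.refl = ≡.refl
      root′ : ∀ i → poly u (quotient u cs a) (f (suc i)) ≈ 0#
      root′ i with integral {f (suc i) - a} {poly u (quotient u cs a) (f (suc i))} (begin
          (f (suc i) - a) * poly u (quotient u cs a) (f (suc i))               ≈⟨ +-identityˡ _ ⟨
          0# + (f (suc i) - a) * poly u (quotient u cs a) (f (suc i))          ≈⟨ +-congʳ (root zero) ⟨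
          poly u cs a + (f (suc i) - a) * poly u (quotient u cs a) (f (suc i)) ≈⟨ poly-quotient u cs (x≈y+[x-y] _ a) ⟨
          poly u cs (f (suc i))                                               ≈⟨ root (suc i) ⟩
          0#                                                                  ∎)
      ... | inj₂ Q≈0 = Q≈0
      ... | inj₁ d≈0 with dist {suc i} {zero} (trans (x≈y+[x-y] (f (suc i)) a) (trans (+-congˡ d≈0) (+-identityʳ a)))
      ... | ()

    module _ (_≈?_ : Decidable₂ _≈_) where

      normalise : ∀ {n} (cs : Fin n → Carrier) → (∀ i → cs i ≈ 0#) ⊎
        ∃ λ d → d ℕ.< n × Σ (Fin d → Carrier) λ cs′ → ∃ λ u → ¬ u ≈ 0# × (∀ x → poly 0# cs x ≈ poly u cs′ x)
      normalise {zero}  cs = inj₁ λ ()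
      normalise {suc n} cs with normalise (cs ∘ suc)
      ... | inj₂ (d , d<n , cs′ , u , u≉0 , eq) =
        inj₂ (suc d , s≤s d<n , (λ { zero → cs zero ; (suc i) → cs′ i }) , u , u≉0 , λ x → +-congˡ (*-congˡ (eq x)))
      ... | inj₁ cs≈0 with cs zero ≈? 0#
      ... | yes c≈0 = inj₁ λ { zero → c≈0 ; (suc i) → cs≈0 i }
      ... | no  c≉0 = inj₂ (0 , s≤s z≤n , (λ ()) , cs zero , c≉0 , λ x →
                        trans (+-congˡ (trans (*-congˡ (vanish (cs ∘ suc) cs≈0 x)) (zeroʳ x))) (+-identityʳ _))
        where
        vanish : ∀ {m} (bs : Fin m → Carrier) → (∀ i → bs i ≈ 0#) → ∀ x → poly 0# bs x ≈ 0#
        vanish {zero}  bs bs≈0 x = refl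
        vanish {suc m} bs bs≈0 x =
          trans (+-cong (bs≈0 zero) (trans (*-congˡ (vanish (bs ∘ suc) (bs≈0 ∘ suc) x)) (zeroʳ x))) (+-identityʳ _)

      -- With leading zeros dropped, a polynomial that does not vanish identically has degree below
      -- `n`, too small for `n` distinct roots.
      roots⇒vanishing : ∀ {n} (cs f : Fin n → Carrier) → Distinct f →
                        (∀ i → poly 0# cs (f i) ≈ 0#) → ∀ i → cs i ≈ 0#
      roots⇒vanishing cs f dist root with normalise cs
      ... | inj₁ cs≈0 = cs≈0
      ... | inj₂ (d , d<n , cs′ , u , u≉0 , eq) =
        ⊥-elim (ℕ.<⇒≱ d<n (roots≤degree cs′ u≉0 f dist (λ i → trans (sym (eq (f i))) (root i))))

-- `op m x b` stands for `m x + b`, as in a planar ternary ring. `meet` makes lines of different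
-- slopes intersect; `injective` allows at most one line of each slope through a point, which
-- separates the lines and bounds the degrees.
record PlanarTernary (q : ℕ) : Set where
  field
    op        : Fin q → Fin q → Fin q → Fin q
    meet      : ∀ {m m′} b b′ → m ≢ m′ → ∃ λ x → op m x b ≡ op m′ x b′
    injective : ∀ m x {b b′} → op m x b ≡ op m x b′ → b ≡ b′

funToFin-cong : ∀ {m n} {f g : Fin m → Fin n} → (∀ i → f i ≡ g i) → funToFin f ≡ funToFin g
funToFin-cong {zero}  f≗g = ≡.refl
funToFin-cong {suc m} f≗g = ≡.cong₂ Fin.combine (f≗g zero) (funToFin-cong (f≗g ∘ suc))

finToFun-injective : ∀ {m n} {i j : Fin (n ℕ.^ m)} → (∀ a → finToFun {n} {m} i a ≡ finToFun j a) → i ≡ j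
finToFun-injective {m} {n} {i} {j} eq =
  ≡.trans (≡.sym (Fin.funToFin-finToFin {m} i)) (≡.trans (funToFin-cong {m} eq) (Fin.funToFin-finToFin {m} j))

module FiniteField {c e} (R : CommutativeRing c e) (p k : ℕ) (pr : Prime p)
  (p×1≈0 : CommutativeRing._≈_ R (Multiplication._×_ (CommutativeRing.semiring R) p (CommutativeRing.1# R))
                                 (CommutativeRing.0# R)) where

  open CommutativeRing R hiding (zero)
  open Multiplication semiring renaming (_×_ to _⊠_)
  open Exponentiation commutativeSemiring
  open RingProperties ring
  open Frobenius R p pr p×1≈0
  open Polynomial R
  open import Relation.Binary.Reasoning.Setoid setoid

  q : ℕ
  q = p ℕ.^ k

  module _ (_≈?_ : Decidable₂ _≈_) (1≉0 : ¬ 1# ≈ 0#)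
    (inverse : ∀ x → x ≈ 0# ⊎ ∃ λ y → y * x ≈ 1#)
    (x^q≈x : ∀ x → x ^ q ≈ x)
    (t : Carrier) (t^pᵈ≉t : ∀ d → 1 ℕ.≤ d → d ℕ.< k → ¬ t ^ (p ℕ.^ d) ≈ t) where

    integral : ∀ {x y} → x * y ≈ 0# → x ≈ 0# ⊎ y ≈ 0#
    integral {x} {y} xy≈0 with inverse x
    ... | inj₁ x≈0 = inj₁ x≈0
    ... | inj₂ (x⁻¹ , x⁻¹x≈1) = inj₂ (begin
      y               ≈⟨ *-identityˡ y ⟨
      1# * y          ≈⟨ *-congʳ x⁻¹x≈1 ⟨
      (x⁻¹ * x) * y   ≈⟨ *-assoc _ _ _ ⟩
      x⁻¹ * (x * y)   ≈⟨ *-congˡ xy≈0 ⟩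
      x⁻¹ * 0#        ≈⟨ zeroʳ _ ⟩
      0#              ∎)

    open Roots integral

    t^[pʲ]^[pⁱ] : ∀ i j → (t ^ (p ℕ.^ j)) ^ (p ℕ.^ i) ≈ t ^ (p ℕ.^ (j ℕ.+ i))
    t^[pʲ]^[pⁱ] i j = trans (^-assocʳ t (p ℕ.^ j) (p ℕ.^ i)) (^-congʳ t (≡.sym (ℕ.^-distribˡ-+-* p j i)))

    -- Raise a supposed equality to the power `p ^ (k ∸ i)`: one side becomes `t ^ q = t`, and on
    -- the other the exponent `p ^ (j ∸ i + k)` reduces to `p ^ (j ∸ i)` by `x ^ q = x`. This
    -- contradicts the assumption on `t`.
    conjugates≉ : ∀ {i j} → i ℕ.< j → j ℕ.< k → ¬ t ^ (p ℕ.^ i) ≈ t ^ (p ℕ.^ j)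
    conjugates≉ {i} {j} i<j j<k eq = t^pᵈ≉t (j ∸ i) (ℕ.m<n⇒0<n∸m i<j) (ℕ.≤-<-trans (ℕ.m∸n≤m j i) j<k) (begin
      t ^ (p ℕ.^ (j ∸ i))                   ≈⟨ x^q≈x _ ⟨
      (t ^ (p ℕ.^ (j ∸ i))) ^ q             ≈⟨ t^[pʲ]^[pⁱ] k (j ∸ i) ⟩
      t ^ (p ℕ.^ (j ∸ i ℕ.+ k))             ≈⟨ ^-congʳ t (≡.cong (p ℕ.^_) exponent) ⟩
      t ^ (p ℕ.^ (j ℕ.+ (k ∸ i)))           ≈⟨ t^[pʲ]^[pⁱ] (k ∸ i) j ⟨
      (t ^ (p ℕ.^ j)) ^ (p ℕ.^ (k ∸ i))     ≈⟨ ^-congˡ (p ℕ.^ (k ∸ i)) eq ⟨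
      (t ^ (p ℕ.^ i)) ^ (p ℕ.^ (k ∸ i))     ≈⟨ t^[pʲ]^[pⁱ] (k ∸ i) i ⟩
      t ^ (p ℕ.^ (i ℕ.+ (k ∸ i)))           ≈⟨ ^-congʳ t (≡.cong (p ℕ.^_) (ℕ.m+[n∸m]≡n (ℕ.<⇒≤ i<k))) ⟩
      t ^ q                                 ≈⟨ x^q≈x t ⟩
      t                                     ∎)
      where
      i<k = ℕ.<-trans i<j j<k
      exponent : j ∸ i ℕ.+ k ≡ j ℕ.+ (k ∸ i)
      exponent = ≡.trans (≡.sym (ℕ.+-∸-comm k (ℕ.<⇒≤ i<j))) (ℕ.+-∸-assoc j (ℕ.<⇒≤ i<k))

    conjugate : Fin k → Carrier
    conjugate i = t ^ (p ℕ.^ toℕ i)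

    conjugates-distinct : Distinct conjugate
    conjugates-distinct {i} {j} eq with ℕ.<-cmp (toℕ i) (toℕ j)
    ... | tri< i<j _ _ = ⊥-elim (conjugates≉ i<j (Fin.toℕ<n j) eq)
    ... | tri≈ _ i≡j _ = Fin.toℕ-injective i≡j
    ... | tri> _ _ j<i = ⊥-elim (conjugates≉ j<i (Fin.toℕ<n i) (sym eq))

    -- `m` is coprime to `p`. If both multiples of 1 vanished, a Bézout identity would give 1 = 0.
    ×1≉0 : ∀ {m} → 1 ℕ.≤ m → m ℕ.< p → ¬ m ⊠ 1# ≈ 0#
    ×1≉0 {m@(suc _)} _ m<p m×1≈0 = 1≉0 (go (coprime-Bézout (prime⇒coprime pr m<p)))
      where
      multiple : ∀ {n} y → n ⊠ 1# ≈ 0# → (y ℕ.* n) ⊠ 1# ≈ 0#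
      multiple {n} y n×1≈0 = trans (×1-homo-* y n) (trans (*-congˡ n×1≈0) (zeroʳ _))
      unit : ∀ {a b} → a ⊠ 1# ≈ 0# → b ⊠ 1# ≈ 0# → 1 ℕ.+ a ≡ b → 1# ≈ 0#
      unit {a} {b} a×1≈0 b×1≈0 eq = begin
        1#             ≈⟨ +-identityʳ 1# ⟨
        1# + 0#        ≈⟨ +-congˡ a×1≈0 ⟨
        1# + a ⊠ 1#    ≈⟨ ×-congˡ {1#} eq ⟩
        b ⊠ 1#         ≈⟨ b×1≈0 ⟩
        0#             ∎
      go : Bézout.Identity 1 p m → 1# ≈ 0#
      go (Bézout.+- x y eq) = unit (multiple y m×1≈0) (multiple x p×1≈0) eq
      go (Bézout.-+ x y eq) = unit (multiple x p×1≈0) (multiple y m×1≈0) eq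

    ×1-injective< : ∀ {a b} → a ℕ.< b → b ℕ.< p → ¬ a ⊠ 1# ≈ b ⊠ 1#
    ×1-injective< {a} {b} a<b b<p eq = ×1≉0 (ℕ.m<n⇒0<n∸m a<b) (ℕ.≤-<-trans (ℕ.m∸n≤m b a) b<p)
      (+-cancelˡ (a ⊠ 1#) _ _ (begin
        a ⊠ 1# + (b ∸ a) ⊠ 1#  ≈⟨ ×-homo-+ 1# a (b ∸ a) ⟨
        (a ℕ.+ (b ∸ a)) ⊠ 1#   ≈⟨ ×-congˡ {1#} (ℕ.m+[n∸m]≡n (ℕ.<⇒≤ a<b)) ⟩
        b ⊠ 1#                 ≈⟨ eq ⟨
        a ⊠ 1#                 ≈⟨ +-identityʳ _ ⟨
        a ⊠ 1# + 0#            ∎))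

    digit-injective : ∀ {a b : Fin p} → toℕ a ⊠ 1# ≈ toℕ b ⊠ 1# → a ≡ b
    digit-injective {a} {b} eq with ℕ.<-cmp (toℕ a) (toℕ b)
    ... | tri< a<b _ _ = ⊥-elim (×1-injective< a<b (Fin.toℕ<n b) eq)
    ... | tri≈ _ a≡b _ = Fin.toℕ-injective a≡b
    ... | tri> _ _ b<a = ⊥-elim (×1-injective< b<a (Fin.toℕ<n a) (sym eq))

    digits : ∀ {n} → Carrier → (Fin n → Fin p) → Carrier
    digits {zero}  y a = 0#
    digits {suc n} y a = toℕ (a zero) ⊠ 1# + y * digits y (a ∘ suc)

    1^n≈1 : ∀ n → 1# ^ n ≈ 1#
    1^n≈1 zero    = refl
    1^n≈1 (suc n) = trans (*-identityˡ _) (1^n≈1 n)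

    0^pʲ≈0 : ∀ j → 0# ^ (p ℕ.^ j) ≈ 0#
    0^pʲ≈0 j = trans (^-congʳ 0# (≡.sym (ℕ.suc-pred (p ℕ.^ j)))) (zeroˡ _)
      where
      instance
        _ = ℕ.>-nonZero (ℕ.<-trans (s≤s z≤n) (ℕ.nonTrivial⇒n>1 p {{prime⇒nonTrivial pr}}))
        _ = ℕ.m^n≢0 p j

    ×1^pʲ : ∀ j m → (m ⊠ 1#) ^ (p ℕ.^ j) ≈ m ⊠ 1#
    ×1^pʲ j zero    = 0^pʲ≈0 j
    ×1^pʲ j (suc m) = trans (^pʲ-distrib-+ j 1# (m ⊠ 1#)) (+-cong (1^n≈1 (p ℕ.^ j)) (×1^pʲ j m))

    -- Powers of Frobenius are additive and fix the multiples of 1, so they move only the point of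
    -- evaluation.
    digits-frobenius : ∀ j {n} y (a : Fin n → Fin p) →
                       digits y a ^ (p ℕ.^ j) ≈ digits (y ^ (p ℕ.^ j)) a
    digits-frobenius j {zero}  y a = 0^pʲ≈0 j
    digits-frobenius j {suc n} y a = trans (^pʲ-distrib-+ j _ _) (+-cong (×1^pʲ j (toℕ (a zero)))
      (trans (^-distrib-* y _ (p ℕ.^ j)) (*-congˡ (digits-frobenius j y (a ∘ suc)))))

    -- Digits are not closed under subtraction, so the difference of two expansions is a polynomial
    -- with coefficients in the ring, to which `roots⇒vanishing` applies.
    digits-difference : ∀ {n} y (a b : Fin n → Fin p) →
      digits y b + poly 0# (λ i → toℕ (a i) ⊠ 1# - toℕ (b i) ⊠ 1#) y ≈ digits y a
    digits-difference {zero}  y a b = +-identityˡ 0#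
    digits-difference {suc n} y a b = begin
      (b₀ + y * B) + ((a₀ - b₀) + y * D)  ≈⟨ +-assoc _ _ _ ⟩
      b₀ + (y * B + ((a₀ - b₀) + y * D))  ≈⟨ +-congˡ (trans (sym (+-assoc _ _ _)) (trans (+-congʳ (+-comm _ _)) (+-assoc _ _ _))) ⟩
      b₀ + ((a₀ - b₀) + (y * B + y * D))  ≈⟨ +-assoc _ _ _ ⟨
      (b₀ + (a₀ - b₀)) + (y * B + y * D)  ≈⟨ +-cong (sym (x≈y+[x-y] a₀ b₀)) (sym (distribˡ y B D)) ⟩
      a₀ + y * (B + D)                    ≈⟨ +-congˡ (*-congˡ (digits-difference y (a ∘ suc) (b ∘ suc))) ⟩
      a₀ + y * digits y (a ∘ suc)         ∎
      where
      a₀ = toℕ (a zero) ⊠ 1#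
      b₀ = toℕ (b zero) ⊠ 1#
      B  = digits y (b ∘ suc)
      D  = poly 0# (λ i → toℕ (a (suc i)) ⊠ 1# - toℕ (b (suc i)) ⊠ 1#) y

    -- If a polynomial over the prime field vanishes at t then it vanishes at the k conjugates of t.
    digits-injective : (a b : Fin k → Fin p) → digits t a ≈ digits t b → ∀ i → a i ≡ b i
    digits-injective a b eq i = digit-injective (trans (x≈y+[x-y] _ _)
      (trans (+-congˡ (roots⇒vanishing _≈?_ _ conjugate conjugates-distinct root i)) (+-identityʳ _)))
      where
      root : ∀ j → poly 0# (λ i → toℕ (a i) ⊠ 1# - toℕ (b i) ⊠ 1#) (conjugate j) ≈ 0#
      root j = +-cancelˡ (digits y b) _ _ (begin
        digits y b + poly 0# (λ i → toℕ (a i) ⊠ 1# - toℕ (b i) ⊠ 1#) y ≈⟨ digits-difference y a b ⟩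
        digits y a                     ≈⟨ digits-frobenius (toℕ j) t a ⟨
        digits t a ^ (p ℕ.^ toℕ j)     ≈⟨ ^-congˡ (p ℕ.^ toℕ j) eq ⟩
        digits t b ^ (p ℕ.^ toℕ j)     ≈⟨ digits-frobenius (toℕ j) t b ⟩
        digits y b                     ≈⟨ +-identityʳ _ ⟨
        digits y b + 0#                ∎)
        where y = conjugate j

    -- The base-`p` digits of an index serve as coordinates with respect to 1, t, ..., t ^ (k - 1).
    element : Fin q → Carrier
    element i = digits t (finToFun {p} {k} i)

    element-distinct : Distinct element
    element-distinct {i} {j} eq = finToFun-injective {k} {p} (digits-injective _ _ eq)

    distinct≤q : 1 ℕ.< q → ∀ {n} (f : Fin n → Carrier) → Distinct f → n ℕ.≤ q
    distinct≤q 1<q f dist = go q 1<q x^q≈x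
      where
      monomial : ∀ n x → poly {n} 1# (λ _ → 0#) x ≈ x ^ n
      monomial zero    x = refl
      monomial (suc n) x = trans (+-identityˡ _) (*-congˡ (monomial n x))
      go : ∀ q → 1 ℕ.< q → (∀ x → x ^ q ≈ x) → _ ℕ.≤ q
      go (suc zero)    (s≤s ()) _
      go (suc (suc n)) _ x^q≈x = roots≤degree cs 1≉0 f dist (root ∘ f)
        where
        -- The coefficients of X ^ q - X below the leading one; `q` is matched as `suc (suc n)` to
        -- give the linear term its own place.
        cs : Fin (suc (suc n)) → Carrier
        cs zero          = 0#
        cs (suc zero)    = - 1#
        cs (suc (suc _)) = 0#
        root : ∀ x → poly 1# cs x ≈ 0#
        root x = begin
          0# + x * (- 1# + x * poly {n} 1# (λ _ → 0#) x)  ≈⟨ +-identityˡ _ ⟩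
          x * (- 1# + x * poly {n} 1# (λ _ → 0#) x)       ≈⟨ *-congˡ (+-congˡ (*-congˡ (monomial n x))) ⟩
          x * (- 1# + x ^ suc n)                          ≈⟨ distribˡ x _ _ ⟩
          x * - 1# + x ^ suc (suc n)                      ≈⟨ +-cong (trans (sym (-‿distribʳ-* x 1#)) (-‿cong (*-identityʳ x))) (x^q≈x x) ⟩
          - x + x                                         ≈⟨ -‿inverseˡ x ⟩
          0#                                              ∎

    -- An element outside the list would make `q + 1` distinct roots of X ^ q - X.
    element-surjective : 1 ℕ.< q → ∀ x → ∃ λ i → element i ≈ x
    element-surjective 1<q x with Fin.any? (λ i → element i ≈? x)
    ... | yes found = found
    ... | no  none  = ⊥-elim (ℕ.1+n≰n (distinct≤q 1<q f dist))
      where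
      f : Fin (suc q) → Carrier
      f zero    = x
      f (suc i) = element i
      dist : Distinct f
      dist {zero}  {zero}  eq = ≡.refl
      dist {zero}  {suc j} eq = ⊥-elim (none (j , sym eq))
      dist {suc i} {zero}  eq = ⊥-elim (none (i , eq))
      dist {suc i} {suc j} eq = ≡.cong suc (element-distinct eq)

    planarTernary : 1 ℕ.< q → PlanarTernary q
    planarTernary 1<q = record
      { op        = λ m x b → index (value m x b)
      ; meet      = meet
      ; injective = λ m x eq → element-distinct (+-cancelˡ (element m * element x) _ _ (index-injective eq))
      }
      where
      index : Carrier → Fin q
      index x = proj₁ (element-surjective 1<q x)
      index-cong : ∀ {x y} → x ≈ y → index x ≡ index y
      index-cong {x} {y} x≈y = element-distinct
        (trans (proj₂ (element-surjective 1<q x)) (trans x≈y (sym (proj₂ (element-surjective 1<q y)))))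
      index-injective : ∀ {x y} → index x ≡ index y → x ≈ y
      index-injective {x} {y} eq = trans (sym (proj₂ (element-surjective 1<q x)))
        (trans (reflexive (≡.cong element eq)) (proj₂ (element-surjective 1<q y)))
      value : Fin q → Fin q → Fin q → Carrier
      value m x b = element m * element x + element b
      meet : ∀ {m m′} b b′ → m ≢ m′ → ∃ λ x → index (value m x b) ≡ index (value m′ x b′)
      meet {m} {m′} b b′ m≢m′ with inverse (element m - element m′)
      ... | inj₁ δ≈0 = ⊥-elim (m≢m′ (element-distinct
              (trans (x≈y+[x-y] (element m) (element m′)) (trans (+-congˡ δ≈0) (+-identityʳ _)))))
      -- The equation `m x + b = m′ x + b′` has the solution `x = (b′ − b) / (m − m′)`.
      ... | inj₂ (δ⁻¹ , δ⁻¹δ≈1) with element-surjective 1<q (δ⁻¹ * (element b′ - element b))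
      ... | x , x≈ = x , index-cong (begin
        M * X + B              ≈⟨ +-congʳ (trans (*-congʳ (x≈y+[x-y] M M′)) (distribʳ X M′ δ)) ⟩
        (M′ * X + δ * X) + B   ≈⟨ +-assoc _ _ _ ⟩
        M′ * X + (δ * X + B)   ≈⟨ +-congˡ (begin
            δ * X + B            ≈⟨ +-comm _ _ ⟩
            B + δ * X            ≈⟨ +-congˡ (begin
              δ * X                       ≈⟨ *-congˡ x≈ ⟩
              δ * (δ⁻¹ * (B′ - B))        ≈⟨ *-assoc _ _ _ ⟨
              (δ * δ⁻¹) * (B′ - B)        ≈⟨ *-congʳ (trans (*-comm δ δ⁻¹) δ⁻¹δ≈1) ⟩
              1# * (B′ - B)               ≈⟨ *-identityˡ _ ⟩
              B′ - B                      ∎) ⟩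
            B + (B′ - B)         ≈⟨ x≈y+[x-y] B′ B ⟨
            B′                   ∎) ⟩
        M′ * X + B′            ∎)
        where
        M  = element m
        M′ = element m′
        δ  = M - M′
        B  = element b
        B′ = element b′
        X  = element x

-- Residue fields of finite rings

module Quotient {A : Set} (_+_ _*_ : A → A → A) (-_ : A → A) (0# 1# : A) where

  record FiniteRing (_≈_ : Rel A 0ℓ) : Set where
    field
      isCommutativeRing : IsCommutativeRing _≈_ _+_ _*_ -_ 0# 1#
      _≈?_              : Decidable₂ _≈_
      elements          : List A
      complete          : ∀ x → Any (x ≈_) elements

    commutativeRing : CommutativeRing 0ℓ 0ℓ
    commutativeRing = record { isCommutativeRing = isCommutativeRing }

  -- The carrier is kept and only the equality is coarsened.
  Modulo : Rel A 0ℓ → A → Rel A 0ℓ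
  Modulo _≈_ a x y = ∃ λ r → x ≈ (y + (r * a))

  module _ {_≈_ : Rel A 0ℓ} (F : FiniteRing _≈_) (a : A) where

    open FiniteRing F
    open CommutativeRing commutativeRing hiding (_≈_; _+_; _*_; -_; 0#; 1#; isCommutativeRing)
    open RingProperties ring
    open import Relation.Binary.Reasoning.Setoid setoid

    ≈⇒modulo : ∀ {x y} → x ≈ y → Modulo _≈_ a x y
    ≈⇒modulo {x} {y} x≈y = 0# , trans x≈y (sym (trans (+-congˡ (zeroˡ a)) (+-identityʳ y)))

    private
      _≈ₐ_ = Modulo _≈_ a

      ≈ₐ-sym : ∀ {x y} → x ≈ₐ y → y ≈ₐ x
      ≈ₐ-sym {x} {y} (r , eq) = (- r) , (begin
        y                               ≈⟨ +-identityʳ y ⟨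
        y + 0#                          ≈⟨ +-congˡ (-‿inverseʳ (r * a)) ⟨
        y + ((r * a) + (- (r * a)))     ≈⟨ +-assoc _ _ _ ⟨
        (y + (r * a)) + (- (r * a))     ≈⟨ +-cong (sym eq) (-‿distribˡ-* r a) ⟩
        x + ((- r) * a)                 ∎)

      ≈ₐ-trans : ∀ {x y z} → x ≈ₐ y → y ≈ₐ z → x ≈ₐ z
      ≈ₐ-trans {x} {y} {z} (r , eq) (s , eq′) = (s + r) , (begin
        x                               ≈⟨ eq ⟩
        y + (r * a)                     ≈⟨ +-congʳ eq′ ⟩
        (z + (s * a)) + (r * a)         ≈⟨ +-assoc _ _ _ ⟩
        z + ((s * a) + (r * a))         ≈⟨ +-congˡ (distribʳ a s r) ⟨
        z + ((s + r) * a)               ∎)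

      ≈ₐ-+-cong : ∀ {x y u v} → x ≈ₐ y → u ≈ₐ v → (x + u) ≈ₐ (y + v)
      ≈ₐ-+-cong {x} {y} {u} {v} (r , eq) (s , eq′) = (r + s) , (begin
        x + u                               ≈⟨ +-cong eq eq′ ⟩
        (y + (r * a)) + (v + (s * a))       ≈⟨ +-assoc _ _ _ ⟩
        y + ((r * a) + (v + (s * a)))       ≈⟨ +-congˡ (trans (sym (+-assoc _ _ _)) (trans (+-congʳ (+-comm _ _)) (+-assoc _ _ _))) ⟩
        y + (v + ((r * a) + (s * a)))       ≈⟨ +-assoc _ _ _ ⟨
        (y + v) + ((r * a) + (s * a))       ≈⟨ +-congˡ (distribʳ a r s) ⟨
        (y + v) + ((r + s) * a)             ∎)

      ≈ₐ-neg-cong : ∀ {x y} → x ≈ₐ y → (- x) ≈ₐ (- y)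
      ≈ₐ-neg-cong {x} {y} (r , eq) = (- r) , (begin
        - x                                 ≈⟨ -‿cong eq ⟩
        - (y + (r * a))                     ≈⟨ -‿+-comm y (r * a) ⟨
        (- y) + (- (r * a))                 ≈⟨ +-congˡ (-‿distribˡ-* r a) ⟩
        (- y) + ((- r) * a)                 ∎)

      ≈ₐ-*-congʳ : ∀ {x y} u → x ≈ₐ y → (x * u) ≈ₐ (y * u)
      ≈ₐ-*-congʳ {x} {y} u (r , eq) = (r * u) , (begin
        x * u                               ≈⟨ *-congʳ eq ⟩
        (y + (r * a)) * u                   ≈⟨ distribʳ u y (r * a) ⟩
        (y * u) + ((r * a) * u)             ≈⟨ +-congˡ (trans (*-assoc r a u) (trans (*-congˡ (*-comm a u)) (sym (*-assoc r u a)))) ⟩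
        (y * u) + ((r * u) * a)             ∎)

      ≈ₐ-*-cong : ∀ {x y u v} → x ≈ₐ y → u ≈ₐ v → (x * u) ≈ₐ (y * v)
      ≈ₐ-*-cong {x} {y} {u} {v} x≈y u≈v = ≈ₐ-trans (≈ₐ-*-congʳ u x≈y)
        (≈ₐ-trans (≈⇒modulo (*-comm y u)) (≈ₐ-trans (≈ₐ-*-congʳ y u≈v) (≈⇒modulo (*-comm v y))))

    modulo : FiniteRing (Modulo _≈_ a)
    modulo = record
      { isCommutativeRing = record
        { isRing = record
          { +-isAbelianGroup = record
            { isGroup = record
              { isMonoid = record
                { isSemigroup = record
                  { isMagma = record
                    { isEquivalence = record { refl = ≈⇒modulo refl ; sym = ≈ₐ-sym ; trans = ≈ₐ-trans }
                    ; ∙-cong        = ≈ₐ-+-cong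
                    }
                  ; assoc = λ x y z → ≈⇒modulo (+-assoc x y z)
                  }
                ; identity = (λ x → ≈⇒modulo (+-identityˡ x)) , (λ x → ≈⇒modulo (+-identityʳ x))
                }
              ; inverse = (λ x → ≈⇒modulo (-‿inverseˡ x)) , (λ x → ≈⇒modulo (-‿inverseʳ x))
              ; ⁻¹-cong = ≈ₐ-neg-cong
              }
            ; comm = λ x y → ≈⇒modulo (+-comm x y)
            }
          ; *-cong     = ≈ₐ-*-cong
          ; *-assoc    = λ x y z → ≈⇒modulo (*-assoc x y z)
          ; *-identity = (λ x → ≈⇒modulo (*-identityˡ x)) , (λ x → ≈⇒modulo (*-identityʳ x))
          ; distrib    = (λ x y z → ≈⇒modulo (distribˡ x y z)) , (λ x y z → ≈⇒modulo (distribʳ x y z))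
          }
        ; *-comm = λ x y → ≈⇒modulo (*-comm x y)
        }
      ; _≈?_     = decide
      ; elements = elements
      ; complete = λ x → Any.map ≈⇒modulo (complete x)
      }
      where
      decide : Decidable₂ (Modulo _≈_ a)
      decide x y = Dec.map′ Any.satisfied (λ (r , eq) → Any.map (λ r≈s → trans eq (+-congˡ (*-congʳ r≈s))) (complete r))
        (Any.any? (λ r → x ≈? (y + (r * a))) elements)

    modulo-≈0 : Modulo _≈_ a a 0#
    modulo-≈0 = 1# , trans (sym (*-identityˡ a)) (sym (+-identityˡ _))

  ZeroOrUnit : Rel A 0ℓ → A → Set
  ZeroOrUnit _≈_ x = (x ≈ 0#) ⊎ ∃ λ y → (y * x) ≈ 1#

  -- If 1 survives modulo `a`, pass to that quotient, where `a` is zero; otherwise 1 is a multiple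
  -- of `a`, which is thus a unit already. Both outcomes persist under coarser equalities, so one
  -- pass through a complete list yields a field.
  residueAt : ∀ {_≈_} → FiniteRing _≈_ → ¬ 1# ≈ 0# → (as : List A) →
              Σ (Rel A 0ℓ) λ _≈′_ → FiniteRing _≈′_ × (∀ {x y} → x ≈ y → x ≈′ y) ×
                ¬ 1# ≈′ 0# × All (ZeroOrUnit _≈′_) as
  residueAt {_≈_} F 1≉0 []       = _≈_ , F , (λ eq → eq) , 1≉0 , []
  residueAt {_≈_} F 1≉0 (a ∷ as) with FiniteRing._≈?_ (modulo F a) 1# 0#
  ... | no  1≉ₐ0 = let _≈′_ , F′ , ≈⇒≈′ , 1≉′0 , units = residueAt (modulo F a) 1≉ₐ0 as in
    _≈′_ , F′ , ≈⇒≈′ ∘ ≈⇒modulo F a , 1≉′0 , inj₁ (≈⇒≈′ (modulo-≈0 F a)) ∷ units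
  ... | yes (r , 1≈0+ra) = let _≈′_ , F′ , ≈⇒≈′ , 1≉′0 , units = residueAt F 1≉0 as in
    _≈′_ , F′ , ≈⇒≈′ , 1≉′0 , inj₂ (r , ≈⇒≈′ (sym (trans 1≈0+ra (+-identityˡ _)))) ∷ units
    where open IsCommutativeRing (FiniteRing.isCommutativeRing F)

  residueField : ∀ {_≈_} → FiniteRing _≈_ → ¬ 1# ≈ 0# →
                 Σ (Rel A 0ℓ) λ _≈′_ → FiniteRing _≈′_ × (∀ {x y} → x ≈ y → x ≈′ y) ×
                   ¬ 1# ≈′ 0# × (∀ x → ZeroOrUnit _≈′_ x)
  residueField {_≈_} F 1≉0 =
    let _≈′_ , F′ , ≈⇒≈′ , 1≉′0 , units = residueAt F 1≉0 (FiniteRing.elements F)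
        open IsCommutativeRing (FiniteRing.isCommutativeRing F′)
        transfer : ∀ {x a} → x ≈′ a → ZeroOrUnit _≈′_ a → ZeroOrUnit _≈′_ x
        transfer x≈a = Sum.map (trans x≈a) λ (y , eq) → y , trans (*-congˡ x≈a) eq
        pick : ∀ {x as} → All (ZeroOrUnit _≈′_) as → Any (λ a → x ≈ a) as → ZeroOrUnit _≈′_ x
        pick units found = All.lookupWith (λ u x≈a → transfer (≈⇒≈′ x≈a) u) units found
    in _≈′_ , F′ , ≈⇒≈′ , 1≉′0 , λ x → pick units (FiniteRing.complete F x)

  -- As e x = x, a relation 1 ∈ (1 − e) would give x ∈ (x − e x) = 0.
  residueFieldAvoiding : ∀ {_≈_} → FiniteRing _≈_ → ∀ {x e} → (x * e) ≈ x → ¬ x ≈ 0# →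
                         Σ (Rel A 0ℓ) λ _≈′_ → FiniteRing _≈′_ × (∀ {x y} → x ≈ y → x ≈′ y) ×
                           ¬ 1# ≈′ 0# × (∀ x → ZeroOrUnit _≈′_ x) × (e ≈′ 1#)
  residueFieldAvoiding {_≈_} F {x} {e} xe≈x x≉0 =
    let _≈′_ , F′ , ≈ₑ⇒≈′ , 1≉′0 , units = residueField (modulo F 1-e) 1≉0
        module F′ = IsCommutativeRing (FiniteRing.isCommutativeRing F′)
        ≈⇒≈′ : ∀ {x y} → x ≈ y → x ≈′ y
        ≈⇒≈′ = λ eq → ≈ₑ⇒≈′ (≈⇒modulo F 1-e eq)
        e≈′1 : e ≈′ 1#
        e≈′1 = F′.trans (≈⇒≈′ (sym (+-identityˡ e))) (F′.trans (F′.+-congʳ (F′.sym (≈ₑ⇒≈′ (modulo-≈0 F 1-e))))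
                 (≈⇒≈′ (trans (+-assoc 1# (- e) e) (trans (+-congˡ (-‿inverseˡ e)) (+-identityʳ 1#)))))
    in _≈′_ , F′ , ≈⇒≈′ , 1≉′0 , units , e≈′1
    where
    open CommutativeRing (FiniteRing.commutativeRing F) hiding (_≈_; _+_; _*_; -_; 0#; 1#)
    open RingProperties ring
    open import Relation.Binary.Reasoning.Setoid setoid
    1-e = 1# + (- e)
    1≉0 : ¬ Modulo _≈_ 1-e 1# 0#
    1≉0 (r , 1≈) = x≉0 (begin
      x                               ≈⟨ *-identityʳ x ⟨
      x * 1#                          ≈⟨ *-congˡ (trans 1≈ (+-identityˡ _)) ⟩
      x * (r * 1-e)                   ≈⟨ *-congˡ (*-comm r 1-e) ⟩
      x * (1-e * r)                   ≈⟨ *-assoc x 1-e r ⟨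
      (x * 1-e) * r                   ≈⟨ *-congʳ (distribˡ x 1# (- e)) ⟩
      ((x * 1#) + (x * (- e))) * r    ≈⟨ *-congʳ (+-cong (*-identityʳ x) (trans (sym (-‿distribʳ-* x e)) (-‿cong xe≈x))) ⟩
      (x + (- x)) * r                 ≈⟨ *-congʳ (-‿inverseʳ x) ⟩
      0# * r                          ≈⟨ zeroˡ r ⟩
      0#                              ∎)

-- The ring of polynomials over the integers modulo p, with T ^ q = T

module MonomialSums where

  open import Algebra.Properties.CommutativeSemigroup ℕ.+-commutativeSemigroup using (interchange)
  open import Data.List using (_++_)
  open import Data.Nat using (_+_; _*_)
  open import Data.Nat.Properties
  open import Relation.Binary.PropositionalEquality using (refl; sym; trans; cong; cong₂; subst)

  ∑ : List ℕ → (ℕ → ℕ) → ℕ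
  ∑ []       f = 0
  ∑ (i ∷ xs) f = f i + ∑ xs f

  ∑-cong : ∀ xs {f g} → (∀ i → f i ≡ g i) → ∑ xs f ≡ ∑ xs g
  ∑-cong []       eq = refl
  ∑-cong (i ∷ xs) eq = cong₂ _+_ (eq i) (∑-cong xs eq)

  ∑-++ : ∀ xs ys f → ∑ (xs ++ ys) f ≡ ∑ xs f + ∑ ys f
  ∑-++ []       ys f = refl
  ∑-++ (i ∷ xs) ys f = trans (cong (f i +_) (∑-++ xs ys f)) (sym (+-assoc (f i) _ _))

  ∑-map : ∀ g xs f → ∑ (map g xs) f ≡ ∑ xs (f ∘ g)
  ∑-map g []       f = refl
  ∑-map g (i ∷ xs) f = cong (f (g i) +_) (∑-map g xs f)

  ∑-zero : ∀ xs → ∑ xs (λ _ → 0) ≡ 0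
  ∑-zero []       = refl
  ∑-zero (i ∷ xs) = ∑-zero xs

  ∑-+ : ∀ xs f g → ∑ xs (λ i → f i + g i) ≡ ∑ xs f + ∑ xs g
  ∑-+ []       f g = refl
  ∑-+ (i ∷ xs) f g = trans (cong (f i + g i +_) (∑-+ xs f g)) (interchange (f i) (g i) _ _)

  ∑-swap : ∀ xs ys (f : ℕ → ℕ → ℕ) → ∑ xs (λ i → ∑ ys (f i)) ≡ ∑ ys (λ j → ∑ xs (λ i → f i j))
  ∑-swap []       ys f = sym (∑-zero ys)
  ∑-swap (i ∷ xs) ys f = trans (cong (∑ ys (f i) +_) (∑-swap xs ys f)) (sym (∑-+ ys (f i) _))

  -- A list of exponents stands for the sum of the corresponding powers of T.
  _⊕_ _⊛_ : List ℕ → List ℕ → List ℕ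
  _⊕_ = _++_
  []       ⊛ ys = []
  (i ∷ xs) ⊛ ys = map (i +_) ys ++ (xs ⊛ ys)

  ∑-⊛ : ∀ xs ys f → ∑ (xs ⊛ ys) f ≡ ∑ xs (λ i → ∑ ys (λ j → f (i + j)))
  ∑-⊛ []       ys f = refl
  ∑-⊛ (i ∷ xs) ys f = trans (∑-++ (map (i +_) ys) _ f) (cong₂ _+_ (∑-map (i +_) ys f) (∑-⊛ xs ys f))

  times : ℕ → List ℕ → List ℕ
  times zero    xs = []
  times (suc n) xs = xs ++ times n xs

  ∑-times : ∀ n xs f → ∑ (times n xs) f ≡ n * ∑ xs f
  ∑-times zero    xs f = refl
  ∑-times (suc n) xs f = trans (∑-++ xs _ f) (cong (∑ xs f +_) (∑-times n xs f))

  ∑< : ℕ → (ℕ → ℕ) → ℕ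
  ∑< zero    f = 0
  ∑< (suc n) f = f n + ∑< n f

  δ : ℕ → ℕ → ℕ
  δ m i with i ≟ m
  ... | yes _ = 1
  ... | no  _ = 0

  δ-refl : ∀ m → δ m m ≡ 1
  δ-refl m with m ≟ m
  ... | yes _   = refl
  ... | no  m≢m = ⊥-elim (m≢m refl)

  δ-≢ : ∀ {m i} → i ≢ m → δ m i ≡ 0
  δ-≢ {m} {i} i≢m with i ≟ m
  ... | yes i≡m = ⊥-elim (i≢m i≡m)
  ... | no  _   = refl

  ∑<-+ : ∀ n f g → ∑< n (λ i → f i + g i) ≡ ∑< n f + ∑< n g
  ∑<-+ zero    f g = refl
  ∑<-+ (suc n) f g = trans (cong (f n + g n +_) (∑<-+ n f g)) (interchange (f n) (g n) _ _)

  ∑<-zero : ∀ n {f} → (∀ i → i < n → f i ≡ 0) → ∑< n f ≡ 0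
  ∑<-zero zero    f≡0 = refl
  ∑<-zero (suc n) f≡0 = cong₂ _+_ (f≡0 n ≤-refl) (∑<-zero n λ i i<n → f≡0 i (m<n⇒m<1+n i<n))

  ∑<-δ : ∀ n (f : ℕ → ℕ) {r} → r < n → ∑< n (λ m → f m * δ m r) ≡ f r
  ∑<-δ (suc n) f {r} r<1+n with r ≟ n
  ... | yes refl = trans (cong₂ _+_ (*-identityʳ (f n))
        (∑<-zero n λ i i<n → trans (cong (f i *_) (δ-≢ (λ n≡i → <-irrefl (sym n≡i) i<n))) (*-zeroʳ (f i)))) (+-identityʳ (f n))
  ... | no  r≢n  = trans (cong (_+ ∑< n (λ m → f m * δ m r)) (*-zeroʳ (f n))) (∑<-δ n f (≤∧≢⇒< (≤-pred r<1+n) r≢n))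

  module TruncatedPolynomials (p q : ℕ) {{_ : NonZero p}} (1<q : 1 < q) where

    infix 4 _≡ₚ_
    _≡ₚ_ : ℕ → ℕ → Set
    a ≡ₚ b = a % p ≡ b % p

    +-congₚ : ∀ {a b c d} → a ≡ₚ b → c ≡ₚ d → a + c ≡ₚ b + d
    +-congₚ {a} {b} {c} {d} eq eq′ = trans (%-distribˡ-+ a c p)
      (trans (cong₂ (λ x y → (x + y) % p) eq eq′) (sym (%-distribˡ-+ b d p)))

    *-congₚ : ∀ {a b c d} → a ≡ₚ b → c ≡ₚ d → a * c ≡ₚ b * d
    *-congₚ {a} {b} {c} {d} eq eq′ = trans (%-distribˡ-* a c p)
      (trans (cong₂ (λ x y → (x * y) % p) eq eq′) (sym (%-distribˡ-* b d p)))

    ∑<-congₚ : ∀ n {f g} → (∀ m → m < n → f m ≡ₚ g m) → ∑< n f ≡ₚ ∑< n g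
    ∑<-congₚ zero    eq = refl
    ∑<-congₚ (suc n) eq = +-congₚ (eq n ≤-refl) (∑<-congₚ n λ m m<n → eq m (m<n⇒m<1+n m<n))

    -- T ^ ρ i is the normal form of T ^ i modulo T ^ q = T.
    next : ℕ → ℕ
    next m with suc m ≟ q
    ... | yes _ = 1
    ... | no  _ = suc m

    ρ : ℕ → ℕ
    ρ zero    = 0
    ρ (suc i) = next (ρ i)

    next^ : ℕ → ℕ → ℕ
    next^ zero    m = m
    next^ (suc i) m = next (next^ i m)

    -- The normal form of a sum of exponents depends on `j` only through `ρ j`; this is what makes
    -- multiplication well defined modulo T ^ q = T.
    ρ-+ : ∀ i j → ρ (i + j) ≡ next^ i (ρ j)
    ρ-+ zero    j = refl
    ρ-+ (suc i) j = cong next (ρ-+ i j)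

    next<q : ∀ {m} → m < q → next m < q
    next<q {m} m<q with suc m ≟ q
    ... | yes _     = 1<q
    ... | no  1+m≢q = ≤∧≢⇒< m<q 1+m≢q

    ρ<q : ∀ i → ρ i < q
    ρ<q zero    = <-trans (s≤s z≤n) 1<q
    ρ<q (suc i) = next<q (ρ<q i)

    ρ-id : ∀ {i} → i < q → ρ i ≡ i
    ρ-id {zero}  _     = refl
    ρ-id {suc i} 1+i<q with ρ i | ρ-id (<-trans (n<1+n i) 1+i<q)
    ... | _ | refl with suc i ≟ q
    ... | yes refl = ⊥-elim (<-irrefl refl 1+i<q)
    ... | no  _    = refl

    next[q-1] : ∀ {i} → suc i ≡ q → next i ≡ 1
    next[q-1] {i} eq with suc i ≟ q
    ... | yes _  = refl
    ... | no neq = ⊥-elim (neq eq)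

    ρ-q : ∀ n → n ≡ q → ρ n ≡ 1
    ρ-q zero    refl = ⊥-elim (n≮0 1<q)
    ρ-q (suc n) eq   = trans (cong next (ρ-id (≤-reflexive eq))) (next[q-1] eq)

    infix 4 _≈_
    -- Equality is tested by all functions of the normal form, not by comparing coefficients: most
    -- ring laws then become identities between sums, and compatibility with products becomes a
    -- change of the test function.
    record _≈_ (xs ys : List ℕ) : Set where
      constructor mk≈
      field pairing : ∀ f → ∑ xs (f ∘ ρ) ≡ₚ ∑ ys (f ∘ ρ)
    open _≈_ public

    ∑≡⇒≈ : ∀ {xs ys} → (∀ f → ∑ xs f ≡ ∑ ys f) → xs ≈ ys
    ∑≡⇒≈ eq = mk≈ λ f → cong (_% p) (eq (f ∘ ρ))

    count : ℕ → List ℕ → ℕ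
    count m xs = ∑ xs (δ m ∘ ρ)

    -- Every test function is a combination of the `q` indicators `δ m`. Hence the `q` coefficients
    -- determine the class of a list, and equality is decidable.
    ∑-count : ∀ xs f → ∑ xs (f ∘ ρ) ≡ ∑< q (λ m → f m * count m xs)
    ∑-count []       f = sym (∑<-zero q λ m _ → *-zeroʳ (f m))
    ∑-count (i ∷ xs) f = trans (cong₂ _+_ (sym (∑<-δ q f (ρ<q i))) (∑-count xs f))
      (trans (sym (∑<-+ q (λ m → f m * δ m (ρ i)) (λ m → f m * count m xs)))
             (∑<-cong q λ m → sym (*-distribˡ-+ (f m) (δ m (ρ i)) (count m xs))))
      where
      ∑<-cong : ∀ n {f g} → (∀ m → f m ≡ g m) → ∑< n f ≡ ∑< n g
      ∑<-cong zero    eq = refl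
      ∑<-cong (suc n) eq = cong₂ _+_ (eq n) (∑<-cong n eq)

    count⇒≈ : ∀ {xs ys} → (∀ m → m < q → count m xs ≡ₚ count m ys) → xs ≈ ys
    count⇒≈ {xs} {ys} eq = mk≈ λ f → trans (cong (_% p) (∑-count xs f))
      (trans (∑<-congₚ q λ m m<q → *-congₚ {f m} {f m} refl (eq m m<q)) (cong (_% p) (sym (∑-count ys f))))

    _≈?_ : Decidable₂ _≈_
    xs ≈? ys = Dec.map′
      (λ eq → count⇒≈ λ m m<q → subst (λ m → count m xs ≡ₚ count m ys) (Fin.toℕ-fromℕ< m<q) (eq (fromℕ< m<q)))
      (λ eq m → pairing eq (δ (toℕ m)))
      (Fin.all? λ (m : Fin q) → count (toℕ m) xs % p ≟ count (toℕ m) ys % p)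

    combinations : ℕ → List (List ℕ)
    combinations zero    = [] ∷ []
    combinations (suc n) = cartesianProductWith (λ c w → times c (n ∷ []) ++ w) (upTo p) (combinations n)

    normalForm : ℕ → List ℕ → List ℕ
    normalForm zero    xs = []
    normalForm (suc n) xs = times (count n xs % p) (n ∷ []) ++ normalForm n xs

    normalForm∈combinations : ∀ n xs → normalForm n xs ListMem.∈ combinations n
    normalForm∈combinations zero    xs = here refl
    normalForm∈combinations (suc n) xs = ListMem.∈-cartesianProductWith⁺ (λ c w → times c (n ∷ []) ++ w)
      (ListMem.∈-upTo⁺ (m%n<n (count n xs) p)) (normalForm∈combinations n xs)

    ∑-normalForm : ∀ n xs f → ∑ (normalForm n xs) f ≡ ∑< n (λ m → (count m xs % p) * f m)
    ∑-normalForm zero    xs f = refl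
    ∑-normalForm (suc n) xs f = trans (∑-++ (times (count n xs % p) (n ∷ [])) _ f)
      (cong₂ _+_ (trans (∑-times (count n xs % p) (n ∷ []) f) (cong (count n xs % p *_) (+-identityʳ (f n))))
                 (∑-normalForm n xs f))

    ≈normalForm : ∀ xs → xs ≈ normalForm q xs
    ≈normalForm xs = mk≈ λ f → trans (cong (_% p) (∑-count xs f)) (trans
      (∑<-congₚ q λ m m<q → trans (cong (_% p) (*-comm (f m) (count m xs)))
        (*-congₚ {count m xs} (sym (m%n%n≡m%n (count m xs) p)) (cong (λ i → f i % p) (sym (ρ-id m<q)))))
      (cong (_% p) (sym (∑-normalForm q xs (f ∘ ρ)))))

    -- Lists have no negative coefficients; modulo `p`, taking `p − 1` copies is negation.
    ⊝_ : List ℕ → List ℕ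
    ⊝ xs = times (ℕ.pred p) xs

    ⊝-inverseʳ : ∀ xs → xs ⊕ (⊝ xs) ≈ []
    ⊝-inverseʳ xs = mk≈ λ f → trans (cong (_% p) (trans (∑-++ xs (⊝ xs) (f ∘ ρ))
      (trans (cong (∑ xs (f ∘ ρ) +_) (∑-times (ℕ.pred p) xs (f ∘ ρ)))
      (trans (cong (_* ∑ xs (f ∘ ρ)) (suc-pred p)) (*-comm p _)))))
      (trans (m*n%n≡0 (∑ xs (f ∘ ρ)) p) (sym (m*n%n≡0 0 p)))

    ≈-trans : ∀ {xs ys zs} → xs ≈ ys → ys ≈ zs → xs ≈ zs
    ≈-trans eq eq′ = mk≈ λ f → trans (pairing eq f) (pairing eq′ f)

    ⊕-cong : ∀ {xs ys us vs} → xs ≈ ys → us ≈ vs → xs ⊕ us ≈ ys ⊕ vs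
    ⊕-cong {xs} {ys} {us} {vs} eq eq′ = mk≈ λ f → trans (cong (_% p) (∑-++ xs us (f ∘ ρ)))
      (trans (+-congₚ (pairing eq f) (pairing eq′ f)) (cong (_% p) (sym (∑-++ ys vs (f ∘ ρ)))))

    ⊕-comm : ∀ xs ys → xs ⊕ ys ≈ ys ⊕ xs
    ⊕-comm xs ys = ∑≡⇒≈ λ f → trans (∑-++ xs ys f) (trans (+-comm (∑ xs f) _) (sym (∑-++ ys xs f)))

    ⊝-cong : ∀ {xs ys} → xs ≈ ys → ⊝ xs ≈ ⊝ ys
    ⊝-cong {xs} {ys} eq = mk≈ λ f → trans (cong (_% p) (∑-times (ℕ.pred p) xs (f ∘ ρ)))
      (trans (*-congₚ {ℕ.pred p} refl (pairing eq f)) (cong (_% p) (sym (∑-times (ℕ.pred p) ys (f ∘ ρ)))))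

    ⊛-comm : ∀ xs ys → xs ⊛ ys ≈ ys ⊛ xs
    ⊛-comm xs ys = ∑≡⇒≈ λ f → trans (∑-⊛ xs ys f) (trans (∑-swap xs ys _)
      (trans (∑-cong ys λ j → ∑-cong xs λ i → cong f (+-comm i j)) (sym (∑-⊛ ys xs f))))

    -- Testing a product against `f` is the same as testing its left factor against the function
    -- that sums `f` over all shifts by exponents in `zs`.
    ⊛-congʳ : ∀ {xs ys} zs → xs ≈ ys → xs ⊛ zs ≈ ys ⊛ zs
    ⊛-congʳ {xs} {ys} zs eq = mk≈ λ f → trans (cong (_% p) (expand xs f))
      (trans (pairing eq (λ m → ∑ zs λ j → f (next^ j m))) (cong (_% p) (sym (expand ys f))))
      where
      expand : ∀ xs f → ∑ (xs ⊛ zs) (f ∘ ρ) ≡ ∑ xs ((λ m → ∑ zs λ j → f (next^ j m)) ∘ ρ)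
      expand xs f = trans (∑-⊛ xs zs (f ∘ ρ))
        (∑-cong xs λ i → ∑-cong zs λ j → cong f (trans (cong ρ (+-comm i j)) (ρ-+ j i)))

    ⊛-cong : ∀ {xs ys us vs} → xs ≈ ys → us ≈ vs → xs ⊛ us ≈ ys ⊛ vs
    ⊛-cong {xs} {ys} {us} {vs} eq eq′ = ≈-trans (⊛-congʳ us eq)
      (≈-trans (⊛-comm ys us) (≈-trans (⊛-congʳ ys eq′) (⊛-comm vs ys)))

    ⊛-assoc : ∀ xs ys zs → (xs ⊛ ys) ⊛ zs ≈ xs ⊛ (ys ⊛ zs)
    ⊛-assoc xs ys zs = ∑≡⇒≈ λ f → trans (∑-⊛ (xs ⊛ ys) zs f) (trans (∑-⊛ xs ys _)
      (trans (∑-cong xs λ i → trans (∑-cong ys λ j → ∑-cong zs λ k → cong f (+-assoc i j k))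
                                    (sym (∑-⊛ ys zs (λ m → f (i + m)))))
             (sym (∑-⊛ xs (ys ⊛ zs) f))))

    ⊛-identityˡ : ∀ xs → (0 ∷ []) ⊛ xs ≈ xs
    ⊛-identityˡ xs = ∑≡⇒≈ λ f → trans (∑-⊛ (0 ∷ []) xs f) (+-identityʳ _)

    ⊛-distribʳ : ∀ xs ys zs → (ys ⊕ zs) ⊛ xs ≈ (ys ⊛ xs) ⊕ (zs ⊛ xs)
    ⊛-distribʳ xs ys zs = ∑≡⇒≈ λ f → trans (∑-⊛ (ys ++ zs) xs f) (trans (∑-++ ys zs _)
      (trans (sym (cong₂ _+_ (∑-⊛ ys xs f) (∑-⊛ zs xs f))) (sym (∑-++ (ys ⊛ xs) _ f))))

    ⊛-distribˡ : ∀ xs ys zs → xs ⊛ (ys ⊕ zs) ≈ (xs ⊛ ys) ⊕ (xs ⊛ zs)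
    ⊛-distribˡ xs ys zs = ≈-trans (⊛-comm xs (ys ⊕ zs))
      (≈-trans (⊛-distribʳ xs ys zs) (⊕-cong (⊛-comm ys xs) (⊛-comm zs xs)))

    open Quotient _⊕_ _⊛_ ⊝_ [] (0 ∷ []) public

    finiteRing : FiniteRing _≈_
    finiteRing = record
      { isCommutativeRing = record
        { isRing = record
          { +-isAbelianGroup = record
            { isGroup = record
              { isMonoid = record
                { isSemigroup = record
                  { isMagma = record
                    { isEquivalence = record
                      { refl  = mk≈ λ f → refl
                      ; sym   = λ eq → mk≈ λ f → sym (pairing eq f)
                      ; trans = ≈-trans
                      }
                    ; ∙-cong = ⊕-cong
                    }
                  ; assoc = λ xs ys zs → ∑≡⇒≈ λ f → trans (∑-++ (xs ++ ys) zs f)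
                      (trans (cong (_+ ∑ zs f) (∑-++ xs ys f)) (trans (+-assoc (∑ xs f) _ _)
                      (sym (trans (∑-++ xs (ys ++ zs) f) (cong (∑ xs f +_) (∑-++ ys zs f))))))
                  }
                ; identity = (λ xs → mk≈ λ f → refl) , (λ xs → ⊕-comm xs [])
                }
              ; inverse = (λ xs → ≈-trans (⊕-comm (⊝ xs) xs) (⊝-inverseʳ xs)) , ⊝-inverseʳ
              ; ⁻¹-cong = ⊝-cong
              }
            ; comm = ⊕-comm
            }
          ; *-cong     = ⊛-cong
          ; *-assoc    = ⊛-assoc
          ; *-identity = ⊛-identityˡ , (λ xs → ≈-trans (⊛-comm xs (0 ∷ [])) (⊛-identityˡ xs))
          ; distrib    = ⊛-distribˡ , ⊛-distribʳ
          }
        ; *-comm = ⊛-comm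
        }
      ; _≈?_     = _≈?_
      ; elements = combinations q
      ; complete = λ xs → Any.map (λ eq → subst (xs ≈_) eq (≈normalForm xs)) (normalForm∈combinations q xs)
      }

open MonomialSums using (∑; δ; δ-refl; δ-≢; _⊕_; _⊛_; times; module TruncatedPolynomials)

-- The field of order `p ^ k` as a residue field

module GaloisField (p k : ℕ) (pr : Prime p) (1≤k : 1 ≤ k) where

  q : ℕ
  q = p ℕ.^ k

  1<p : 1 < p
  1<p = ℕ.nonTrivial⇒n>1 p {{prime⇒nonTrivial pr}}

  instance
    p≢0 : NonZero p
    p≢0 = ℕ.>-nonZero (ℕ.<-trans (s≤s z≤n) 1<p)

  1<p^ : ∀ {d} → 1 ≤ d → 1 < p ℕ.^ d
  1<p^ 1≤d = ℕ.<-≤-trans 1<p (ℕ.≤-trans (ℕ.≤-reflexive (≡.sym (ℕ.*-identityʳ p))) (ℕ.^-monoʳ-≤ p 1≤d))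

  1<q : 1 < q
  1<q = 1<p^ 1≤k

  open TruncatedPolynomials p q 1<q
    using (FiniteRing; module FiniteRing; residueFieldAvoiding; ZeroOrUnit;
           finiteRing; count; mk≈; pairing; ρ; ρ-id; ρ-q)

  module A = FiniteRing finiteRing

  open CommutativeRing A.commutativeRing hiding (zero)
  open Multiplication semiring renaming (_×_ to _⊠_)
  open Exponentiation commutativeSemiring

  T : Carrier
  T = 1 ∷ []

  ∑-×1 : ∀ n f → ∑ (n ⊠ 1#) f ≡ n ℕ.* f 0
  ∑-×1 zero    f = ≡.refl
  ∑-×1 (suc n) f = ≡.cong (f 0 ℕ.+_) (∑-×1 n f)

  p×1≈0 : p ⊠ 1# ≈ 0#
  p×1≈0 = mk≈ λ f → ≡.trans (≡.cong (_% p) (≡.trans (∑-×1 p (f ∘ ρ)) (ℕ.*-comm p _)))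
            (≡.trans (m*n%n≡0 (f 0) p) (≡.sym (m*n%n≡0 0 p)))

  T^n≡[n] : ∀ n → T ^ n ≡ n ∷ []
  T^n≡[n] zero    = ≡.refl
  T^n≡[n] (suc n) = ≡.cong (T ⊛_) (T^n≡[n] n)

  T^q≈T : T ^ q ≈ T
  T^q≈T = trans (reflexive (T^n≡[n] q))
    (mk≈ λ f → ≡.cong (λ m → (f m ℕ.+ 0) % p) (≡.trans (ρ-q q ≡.refl) (≡.sym (ρ-id 1<q))))

  open Frobenius A.commutativeRing p pr p×1≈0 using (^pʲ-distrib-+)

  0^n≈0 : ∀ {n} → 0 < n → 0# ^ n ≈ 0#
  0^n≈0 {suc n} (s≤s _) = zeroˡ (0# ^ n)

  -- A list is literally a sum of monomials, coefficients being repetitions. Additivity of the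
  -- `q`-th power leaves only monomials, for which `(T ^ i) ^ q = (T ^ q) ^ i = T ^ i`.
  x^q≈x : ∀ x → x ^ q ≈ x
  x^q≈x []       = 0^n≈0 (ℕ.<-trans (s≤s z≤n) 1<q)
  x^q≈x (i ∷ xs) = begin
    ((i ∷ []) + xs) ^ q         ≈⟨ ^pʲ-distrib-+ k (i ∷ []) xs ⟩
    (i ∷ []) ^ q + xs ^ q       ≈⟨ +-cong monomial (x^q≈x xs) ⟩
    (i ∷ []) + xs               ∎
    where
    open SetoidReasoning setoid
    monomial : (i ∷ []) ^ q ≈ i ∷ []
    monomial = begin
      (i ∷ []) ^ q      ≡⟨ ≡.cong (_^ q) (T^n≡[n] i) ⟨
      (T ^ i) ^ q       ≈⟨ ^-assocʳ T i q ⟩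
      T ^ (i ℕ.* q)     ≡⟨ ≡.cong (T ^_) (ℕ.*-comm i q) ⟩
      T ^ (q ℕ.* i)     ≈⟨ ^-assocʳ T q i ⟨
      (T ^ q) ^ i       ≈⟨ ^-congˡ i T^q≈T ⟩
      T ^ i             ≡⟨ T^n≡[n] i ⟩
      i ∷ []            ∎

  h : ℕ → Carrier
  h zero    = 1#
  h (suc j) = h j * ((p ℕ.^ suc j ∷ []) + (- T))

  deg : ℕ → ℕ
  deg zero    = 0
  deg (suc j) = deg j ℕ.+ p ℕ.^ suc j

  -- The geometric sum p + ... + p ^ j stays below p ^ (j + 1) because `p ≥ 2`.
  deg< : ∀ j → deg j < p ℕ.^ suc j
  deg< zero    = ℕ.<-trans (s≤s z≤n) (1<p^ {1} ℕ.≤-refl)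
  deg< (suc j) = ℕ.<-≤-trans (ℕ.+-monoˡ-< P (deg< j))
    (ℕ.≤-trans (ℕ.≤-reflexive (≡.cong (P ℕ.+_) (≡.sym (ℕ.+-identityʳ P)))) (ℕ.*-monoˡ-≤ P 1<p))
    where P = p ℕ.^ suc j

  monic : ∀ j → ∃ λ lower → h j ≡ deg j ∷ lower × All (_< deg j) lower
  monic zero    = [] , ≡.refl , []
  monic (suc j) with monic j
  ... | lower , eq , lower< = _ , ≡.cong (_* ((P ∷ []) + (- T))) eq ,
    -- The remaining exponents are of two kinds: the top exponent of `h j` plus 1, from the copies
    -- of `T` that make up `- T`, and a lower exponent of `h j` plus at most `P`.
    All.++⁺ (All.map⁺ (All.map (ℕ.+-monoʳ-< (deg j)) (ones< (ℕ.pred p)))) (products lower<)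
    where
    P = p ℕ.^ suc j
    1<P = 1<p^ {suc j} (s≤s z≤n)
    ones< : ∀ n → All (_< P) (times n T)
    ones< zero    = []
    ones< (suc n) = 1<P ∷ ones< n
    products : ∀ {xs} → All (_< deg j) xs → All (_< deg j ℕ.+ P) (xs * ((P ∷ []) + (- T)))
    products []         = []
    products (x< ∷ xs<) = All.++⁺ (All.map⁺ (All.map (ℕ.+-mono-<-≤ x<) (ℕ.≤-refl ∷ All.map ℕ.<⇒≤ (ones< (ℕ.pred p))))) (products xs<)

  count-lower : ∀ {D xs} → D < q → All (_< D) xs → count D xs ≡ 0
  count-lower D<q []         = ≡.refl
  count-lower {D} D<q (_∷_ {i} i<D xs<) = ≡.cong₂ ℕ._+_
    (≡.trans (≡.cong (δ D) (ρ-id (ℕ.<-trans i<D D<q))) (δ-≢ (ℕ.<⇒≢ i<D))) (count-lower D<q xs<)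

  -- In degree below `q` the relation T ^ q = T does not interfere, so the top monomial keeps its
  -- coefficient 1, which is nonzero modulo `p`.
  h≉0 : ∀ j → deg j < q → ¬ h j ≈ 0#
  h≉0 j D<q h≈0 with monic j
  ... | lower , eq , lower< = ⊥-elim (1≢0 (≡.trans (≡.sym (m<n⇒m%n≡m 1<p))
      (≡.trans (≡.sym (≡.cong (_% p) count≡1)) (≡.trans (pairing h≈0 (δ D)) (m*n%n≡0 0 p)))))
    where
    D = deg j
    1≢0 : 1 ≢ 0
    1≢0 ()
    count≡1 : count D (h j) ≡ 1
    count≡1 = ≡.trans (≡.cong (count D) eq)
      (≡.cong₂ ℕ._+_ (≡.trans (≡.cong (δ D) (ρ-id D<q)) (δ-refl D)) (count-lower D<q lower<))

  H : Carrier
  H = h (ℕ.pred k)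

  H≉0 : ¬ H ≈ 0#
  H≉0 = h≉0 (ℕ.pred k) (≡.subst (λ n → deg (ℕ.pred k) < p ℕ.^ n) (ℕ.suc-pred k {{ℕ.>-nonZero 1≤k}}) (deg< (ℕ.pred k)))

  -- An idempotent that generates the same ideal as `H`; imposing `e = 1` makes `H` a unit.
  e : Carrier
  e = H ^ ℕ.pred q

  suc-pred-q : suc (ℕ.pred q) ≡ q
  suc-pred-q = ℕ.suc-pred q {{ℕ.>-nonZero (ℕ.<-trans (s≤s z≤n) 1<q)}}

  He≈H : H * e ≈ H
  He≈H = trans (^-congʳ H suc-pred-q) (x^q≈x H)

  ResidueField : (List ℕ → List ℕ → Set) → Set
  ResidueField _≈ᴷ_ = FiniteRing _≈ᴷ_ × (∀ {x y} → x ≈ y → x ≈ᴷ y) ×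
                      ¬ 1# ≈ᴷ 0# × (∀ x → ZeroOrUnit _≈ᴷ_ x) × e ≈ᴷ 1#

  fromResidueField : ∀ {_≈ᴷ_} → ResidueField _≈ᴷ_ → PlanarTernary q
  fromResidueField {_≈ᴷ_} (K , ≈⇒≈ᴷ , 1≉0 , units , e≈1) =
    FiniteField.planarTernary (FiniteRing.commutativeRing K) p k pr p×1≈ᴷ0
      (FiniteRing._≈?_ K) 1≉0 units x^q≈ᴷx T conjugate≉ 1<q
    where
    module K = CommutativeRing (FiniteRing.commutativeRing K)
    module ^ᴷ = Exponentiation K.commutativeSemiring
    module ×ᴷ = Multiplication K.semiring

    -- Both rings share carrier and operations and differ only in their equality, so the powers
    -- agree propositionally.
    ^≡^ᴷ : ∀ x n → x ^ n ≡ x ^ᴷ.^ n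
    ^≡^ᴷ x zero    = ≡.refl
    ^≡^ᴷ x (suc n) = ≡.cong (x *_) (^≡^ᴷ x n)

    ×≡×ᴷ : ∀ n x → n ⊠ x ≡ n ×ᴷ.× x
    ×≡×ᴷ zero    x = ≡.refl
    ×≡×ᴷ (suc n) x = ≡.cong (x +_) (×≡×ᴷ n x)

    p×1≈ᴷ0 : (p ×ᴷ.× K.1#) K.≈ K.0#
    p×1≈ᴷ0 = ≡.subst (_≈ᴷ 0#) (×≡×ᴷ p 1#) (≈⇒≈ᴷ p×1≈0)

    x^q≈ᴷx : ∀ x → (x ^ᴷ.^ q) K.≈ x
    x^q≈ᴷx x = ≡.subst (_≈ᴷ x) (^≡^ᴷ x q) (≈⇒≈ᴷ (x^q≈x x))

    x≈y⇒x-y≈0 : ∀ {x y} → x ≈ᴷ y → (x + (- y)) ≈ᴷ 0#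
    x≈y⇒x-y≈0 {x} {y} x≈y = K.trans (K.+-congʳ x≈y) (K.-‿inverseʳ y)

    -- The factor with exponent `p ^ d` becomes zero, and `d ≤ j` puts it into the product. Thus a
    -- nonzero `H` forbids every coincidence with 0 < d < k.
    factor : ∀ {d j} → 1 ≤ d → d ≤ j → (p ℕ.^ d ∷ []) ≈ᴷ T → h j ≈ᴷ 0#
    factor {d} {zero}  1≤d d≤0 _ = ⊥-elim (ℕ.<⇒≱ 1≤d d≤0)
    factor {d} {suc j} 1≤d d≤1+j eq with ℕ.m≤n⇒m<n∨m≡n d≤1+j
    ... | inj₁ d<1+j  = K.trans (K.*-congʳ (factor 1≤d (ℕ.≤-pred d<1+j) eq)) (K.zeroˡ ((p ℕ.^ suc j ∷ []) + (- T)))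
    ... | inj₂ ≡.refl = K.trans (K.*-congˡ {h j} (x≈y⇒x-y≈0 eq)) (K.zeroʳ (h j))

    H≉ᴷ0 : ¬ H ≈ᴷ 0#
    H≉ᴷ0 H≈0 = 1≉0 (begin
      1#                    ≈⟨ e≈1 ⟨
      H ^ ℕ.pred q          ≡⟨ ^≡^ᴷ H (ℕ.pred q) ⟩
      H ^ᴷ.^ ℕ.pred q       ≈⟨ ^ᴷ.^-congˡ (ℕ.pred q) H≈0 ⟩
      0# ^ᴷ.^ ℕ.pred q      ≡⟨ ^≡^ᴷ 0# (ℕ.pred q) ⟨
      0# ^ ℕ.pred q         ≈⟨ ≈⇒≈ᴷ (0^n≈0 (ℕ.≤-pred (≡.subst (1 <_) (≡.sym suc-pred-q) 1<q))) ⟩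
      0#                    ∎)
      where open SetoidReasoning K.setoid

    conjugate≉ : ∀ d → 1 ≤ d → d < k → ¬ (T ^ᴷ.^ (p ℕ.^ d)) ≈ᴷ T
    conjugate≉ d 1≤d d<k eq = H≉ᴷ0 (factor 1≤d (ℕ.<⇒≤pred d<k)
      (≡.subst (_≈ᴷ T) (≡.trans (≡.sym (^≡^ᴷ T (p ℕ.^ d))) (T^n≡[n] (p ℕ.^ d))) eq))

  planarTernary : PlanarTernary q
  planarTernary = fromResidueField (proj₂ (residueFieldAvoiding finiteRing He≈H H≉0))

open import Data.Fin.Subset using (inside; outside; _∈_; _∉_; _⊆_; _∪_; _∩_; ∁; ∣_∣; ⁅_⁆; Nonempty)
open import Data.Nat using (_+_; _*_; _^_; _⊔_)
open import Data.Vec using (_++_)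
open import Relation.Binary.PropositionalEquality using (refl; sym; trans; cong; cong₂; subst; subst₂; module ≡-Reasoning)

-- The plane over a planar ternary operation

∣++∣ : ∀ {m n} (A : Subset m) (B : Subset n) → ∣ A ++ B ∣ ≡ ∣ A ∣ + ∣ B ∣
∣++∣ []            B = refl
∣++∣ (inside  ∷ A) B = cong suc (∣++∣ A B)
∣++∣ (outside ∷ A) B = ∣++∣ A B

∈-++ˡ : ∀ {m n} {A : Subset m} (B : Subset n) {x} → x ∈ A → (x ↑ˡ n) ∈ A ++ B
∈-++ˡ B here        = here
∈-++ˡ B (there x∈A) = there (∈-++ˡ B x∈A)

∈-++ʳ : ∀ {m n} (A : Subset m) {B : Subset n} {y} → y ∈ B → (m ↑ʳ y) ∈ A ++ B
∈-++ʳ []      y∈B = y∈B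
∈-++ʳ (_ ∷ A) y∈B = there (∈-++ʳ A y∈B)

∈-++⁻ˡ : ∀ {m n} (A : Subset m) (B : Subset n) {x} → (x ↑ˡ n) ∈ A ++ B → x ∈ A
∈-++⁻ˡ (_ ∷ A) B {zero}  here         = here
∈-++⁻ˡ (_ ∷ A) B {suc x} (there x∈AB) = there (∈-++⁻ˡ A B x∈AB)

∈-++⁻ʳ : ∀ {m n} (A : Subset m) (B : Subset n) {y} → (m ↑ʳ y) ∈ A ++ B → y ∈ B
∈-++⁻ʳ []      B y∈B          = y∈B
∈-++⁻ʳ (_ ∷ A) B (there y∈AB) = ∈-++⁻ʳ A B y∈AB

data Split (m n : ℕ) : Fin (m + n) → Set where
  left  : ∀ x → Split m n (x ↑ˡ n)
  right : ∀ y → Split m n (m ↑ʳ y)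

split : ∀ m n z → Split m n z
split zero    n z       = right z
split (suc m) n zero    = left zero
split (suc m) n (suc z) with split m n z
... | left x  = left (suc x)
... | right y = right y

-- Counting in lists, and subsets of a grid

unique⇒lookup-injective : ∀ {A : Set} {xs : List A} → Unique xs → ∀ {i j} → List.lookup xs i ≡ List.lookup xs j → i ≡ j
unique⇒lookup-injective (_ ∷ _)    {zero}  {zero}  eq = refl
unique⇒lookup-injective (x∉ ∷ _)   {zero}  {suc j} eq = ⊥-elim (All.lookup x∉ (ListMem.∈-lookup j) eq)
unique⇒lookup-injective (x∉ ∷ _)   {suc i} {zero}  eq = ⊥-elim (All.lookup x∉ (ListMem.∈-lookup i) (sym eq))
unique⇒lookup-injective (_ ∷ uniq) {suc i} {suc j} eq = cong suc (unique⇒lookup-injective uniq eq)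

labelling⇒length≤ : ∀ {A : Set} {n} {xs : List A} → Unique xs → (label : A → Fin n) →
  (∀ {a b} → a ListMem.∈ xs → b ListMem.∈ xs → label a ≡ label b → a ≡ b) → length xs ≤ n
labelling⇒length≤ {xs = xs} uniq label inj = Fin.injective⇒≤ {f = label ∘ List.lookup xs}
  (λ eq → unique⇒lookup-injective uniq (inj (ListMem.∈-lookup _) (ListMem.∈-lookup _) eq))

length-filter-map : ∀ {A B : Set} {P : B → Set} (P? : Decidable P) (f : A → B) xs →
  length (filter P? (map f xs)) ≡ length (filter (P? ∘ f) xs)
length-filter-map P? f []       = refl
length-filter-map P? f (x ∷ xs) with P? (f x)
... | yes _ = cong suc (length-filter-map P? f xs)
... | no  _ = length-filter-map P? f xs

length-cartesianProductWith : ∀ {A B C : Set} (f : A → B → C) xs ys →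
  length (cartesianProductWith f xs ys) ≡ length xs * length ys
length-cartesianProductWith f []       ys = refl
length-cartesianProductWith f (x ∷ xs) ys = trans (List.length-++ (map (f x) ys))
  (cong₂ _+_ (List.length-map (f x) ys) (length-cartesianProductWith f xs ys))

length-allFin : ∀ n → length (allFin n) ≡ n
length-allFin n = List.length-tabulate id

deg : ∀ {n} → Fin n → List (Subset n) → ℕ
deg x L = length (filter (x ∈?_) L)

-- A subset of the `k` by `q` grid given slice by slice, in the order in which `combine` numbers the
-- cells.
blocks : ∀ {k q} → (Fin k → Subset q) → Subset (k * q)
blocks {zero}  f = []
blocks {suc k} f = f zero ++ blocks (f ∘ suc)

∈-blocks⁺ : ∀ {k q} (f : Fin k → Subset q) x {y} → y ∈ f x → combine x y ∈ blocks f
∈-blocks⁺ f zero    y∈ = ∈-++ˡ _ y∈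
∈-blocks⁺ f (suc x) y∈ = ∈-++ʳ (f zero) (∈-blocks⁺ (f ∘ suc) x y∈)

∈-blocks⁻ : ∀ {k q} (f : Fin k → Subset q) x {y} → combine x y ∈ blocks f → y ∈ f x
∈-blocks⁻ f zero    y∈ = ∈-++⁻ˡ (f zero) _ y∈
∈-blocks⁻ f (suc x) y∈ = ∈-blocks⁻ (f ∘ suc) x (∈-++⁻ʳ (f zero) _ y∈)

column : ∀ {k q} → Fin k → Fin k → Subset q
column zero    zero    = Subset.⊤
column zero    (suc x) = Subset.⊥
column (suc c) zero    = Subset.⊥
column (suc c) (suc x) = column c x

∈-column⁺ : ∀ {k q} (c : Fin k) {y : Fin q} → y ∈ column c c
∈-column⁺ zero    = Subset.∈⊤
∈-column⁺ (suc c) = ∈-column⁺ c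

∈-column⁻ : ∀ {k q} (c x : Fin k) {y : Fin q} → y ∈ column c x → x ≡ c
∈-column⁻ zero    zero    _  = refl
∈-column⁻ zero    (suc x) y∈ = ⊥-elim (Subset.∉⊥ y∈)
∈-column⁻ (suc c) zero    y∈ = ⊥-elim (Subset.∉⊥ y∈)
∈-column⁻ (suc c) (suc x) y∈ = cong suc (∈-column⁻ c x y∈)

∣blocks∣-constant : ∀ {k q j} (f : Fin k → Subset q) → (∀ x → ∣ f x ∣ ≡ j) → ∣ blocks f ∣ ≡ k * j
∣blocks∣-constant {zero}  f eq = refl
∣blocks∣-constant {suc k} f eq =
  trans (∣++∣ (f zero) _) (cong₂ _+_ (eq zero) (∣blocks∣-constant (f ∘ suc) (eq ∘ suc)))

∣blocks-column∣ : ∀ {k} q (c : Fin k) → ∣ blocks (column {k} {q} c) ∣ ≡ q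
∣blocks-column∣ {suc k} q zero = trans (∣++∣ (Subset.⊤ {q}) (blocks {k} λ _ → Subset.⊥)) (trans
  (cong₂ _+_ (Subset.∣⊤∣≡n q) (trans (∣blocks∣-constant {k} {q} (λ _ → Subset.⊥) (λ _ → Subset.∣⊥∣≡0 q)) (ℕ.*-zeroʳ k)))
  (ℕ.+-identityʳ q))
∣blocks-column∣ {suc k} q (suc c) =
  trans (∣++∣ (Subset.⊥ {q}) (blocks (column c))) (cong₂ _+_ (Subset.∣⊥∣≡0 q) (∣blocks-column∣ q c))

record Plane (q : ℕ) : Set where
  field
    order    : ℕ
    lines    : List (Subset order)
    unique   : Unique lines
    sizes    : All (λ L → ∣ L ∣ ≡ suc q) lines
    meeting  : ∀ {L M} → L ListMem.∈ lines → M ListMem.∈ lines → Nonempty (L ∩ M)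
    count    : length lines ≡ q * q + suc q
    degree≤  : ∀ x → deg x lines ≤ suc q

module PlaneOf {q : ℕ} (i₀ : Fin q) (𝕋 : PlanarTernary q) where

  open PlanarTernary 𝕋

  -- The affine plane completed at infinity: `direction m` is the common point of the lines of slope
  -- `m`, and `apex` that of the vertical lines.
  data Point : Set where
    affine    : Fin q → Fin q → Point
    direction : Fin q → Point
    apex      : Point

  data Line : Set where
    slope    : Fin q → Fin q → Line
    vertical : Fin q → Line
    infinite : Line

  Incident : Point → Line → Set
  Incident (affine x y)  (slope m b)  = y ≡ op m x b
  Incident (affine x y)  (vertical c) = x ≡ c
  Incident (affine x y)  infinite     = ⊥
  Incident (direction d) (slope m b)  = d ≡ m
  Incident (direction d) (vertical c) = ⊥
  Incident (direction d) infinite     = ⊤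
  Incident apex          (slope m b)  = ⊥
  Incident apex          (vertical c) = ⊤
  Incident apex          infinite     = ⊤

  encode : Point → Fin (q * q + suc q)
  encode (affine x y)  = combine x y ↑ˡ suc q
  encode (direction d) = (q * q) ↑ʳ suc d
  encode apex          = (q * q) ↑ʳ zero

  decode : ∀ z → ∃ λ P → encode P ≡ z
  decode z with split (q * q) (suc q) z
  ... | right zero    = apex , refl
  ... | right (suc d) = direction d , refl
  ... | left w with Fin.combine-surjective {q} {q} w
  ... | x , y , refl = affine x y , refl

  affinePart : Line → Subset (q * q)
  affinePart (slope m b)  = blocks {q} λ x → ⁅ op m x b ⁆
  affinePart (vertical c) = blocks {q} (column c)
  affinePart infinite     = Subset.⊥

  idealPart : Line → Subset (suc q)
  idealPart (slope m b)  = outside ∷ ⁅ m ⁆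
  idealPart (vertical c) = inside ∷ Subset.⊥
  idealPart infinite     = Subset.⊤

  points : Line → Subset (q * q + suc q)
  points l = affinePart l ++ idealPart l

  ∈-points⁺ : ∀ P l → Incident P l → encode P ∈ points l
  ∈-points⁺ (affine x y)  (slope m b)  refl = ∈-++ˡ _ (∈-blocks⁺ {q} (λ x → ⁅ op m x b ⁆) x (Subset.x∈⁅x⁆ _))
  ∈-points⁺ (affine x y)  (vertical c) refl = ∈-++ˡ _ (∈-blocks⁺ {q} (column c) x (∈-column⁺ x))
  ∈-points⁺ (direction d) (slope m b)  refl = ∈-++ʳ (affinePart (slope m b)) (there (Subset.x∈⁅x⁆ d))
  ∈-points⁺ (direction d) infinite     _    = ∈-++ʳ (affinePart infinite) Subset.∈⊤
  ∈-points⁺ apex          (vertical c) _    = ∈-++ʳ (affinePart (vertical c)) here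
  ∈-points⁺ apex          infinite     _    = ∈-++ʳ (affinePart infinite) here

  ∈-points⁻ : ∀ P l → encode P ∈ points l → Incident P l
  ∈-points⁻ (affine x y) (slope m b) P∈ =
    Subset.x∈⁅y⁆⇒x≡y _ (∈-blocks⁻ {q} (λ x → ⁅ op m x b ⁆) x (∈-++⁻ˡ (affinePart (slope m b)) _ P∈))
  ∈-points⁻ (affine x y) (vertical c) P∈ =
    ∈-column⁻ c x (∈-blocks⁻ {q} (column c) x (∈-++⁻ˡ (affinePart (vertical c)) _ P∈))
  ∈-points⁻ (affine x y) infinite P∈ = Subset.∉⊥ (∈-++⁻ˡ (affinePart infinite) _ P∈)
  ∈-points⁻ (direction d) (slope m b) P∈ with ∈-++⁻ʳ (affinePart (slope m b)) _ P∈
  ... | there d∈ = Subset.x∈⁅y⁆⇒x≡y m d∈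
  ∈-points⁻ (direction d) (vertical c) P∈ with ∈-++⁻ʳ (affinePart (vertical c)) _ P∈
  ... | there d∈ = Subset.∉⊥ d∈
  ∈-points⁻ (direction d) infinite P∈ = tt
  ∈-points⁻ apex (slope m b) P∈ with ∈-++⁻ʳ (affinePart (slope m b)) _ P∈
  ... | ()
  ∈-points⁻ apex (vertical c) P∈ = tt
  ∈-points⁻ apex infinite P∈ = tt

  ∣points∣ : ∀ l → ∣ points l ∣ ≡ suc q
  ∣points∣ l@(slope m b) = trans (∣++∣ (affinePart l) _) (trans
    (cong₂ _+_ (trans (∣blocks∣-constant {q} {q} _ (λ x → Subset.∣⁅x⁆∣≡1 (op m x b))) (ℕ.*-identityʳ q)) (Subset.∣⁅x⁆∣≡1 m))
    (ℕ.+-comm q 1))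
  ∣points∣ l@(vertical c) = trans (∣++∣ (affinePart l) _) (trans
    (cong₂ _+_ (∣blocks-column∣ q c) (cong suc (Subset.∣⊥∣≡0 q))) (ℕ.+-comm q 1))
  ∣points∣ infinite = trans (∣++∣ (affinePart infinite) _) (cong₂ _+_ (Subset.∣⊥∣≡0 (q * q)) (cong suc (Subset.∣⊤∣≡n q)))

  meet-lines : ∀ l l′ → ∃ λ P → Incident P l × Incident P l′
  meet-lines (slope m b) (slope m′ b′) with m Fin.≟ m′
  ... | yes refl = direction m , refl , refl
  ... | no  m≢m′ = let x , eq = meet b b′ m≢m′ in affine x (op m x b) , refl , eq
  meet-lines (slope m b)  (vertical c) = affine c (op m c b) , refl , refl
  meet-lines (slope m b)  infinite     = direction m , refl , tt
  meet-lines (vertical c) (slope m b)  = affine c (op m c b) , refl , refl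
  meet-lines (vertical c) (vertical d) = apex , tt , tt
  meet-lines (vertical c) infinite     = apex , tt , tt
  meet-lines infinite     (slope m b)  = direction m , tt , refl
  meet-lines infinite     (vertical c) = apex , tt , tt
  meet-lines infinite     infinite     = apex , tt , tt

  -- The points at infinity tell the kinds of lines apart, except that a vertical line differs from
  -- the infinite one by an affine point. The slope is read off at infinity and the intercept above
  -- the abscissa `i₀`.
  points-injective : ∀ {l l′} → points l ≡ points l′ → l ≡ l′
  points-injective {l} {l′} eq = go l l′ (λ P i → ∈-points⁻ P l′ (subst (encode P ∈_) eq (∈-points⁺ P l i)))
                                         (λ P i → ∈-points⁻ P l (subst (encode P ∈_) (sym eq) (∈-points⁺ P l′ i)))
    where
    go : ∀ l l′ → (∀ P → Incident P l → Incident P l′) → (∀ P → Incident P l′ → Incident P l) → l ≡ l′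
    go (slope m b) (slope m′ b′) to _ with to (direction m) refl
    ... | refl = cong (slope m) (injective m i₀ (to (affine i₀ (op m i₀ b)) refl))
    go (slope m b)  (vertical c) _ from = ⊥-elim (from apex tt)
    go (slope m b)  infinite     _ from = ⊥-elim (from apex tt)
    go (vertical c) (slope m b)  to _   = ⊥-elim (to apex tt)
    go (vertical c) (vertical d) to _   = cong vertical (to (affine c c) refl)
    go (vertical c) infinite     to _   = ⊥-elim (to (affine c c) refl)
    go infinite     (slope m b)  to _   = ⊥-elim (to apex tt)
    go infinite     (vertical c) _ from = ⊥-elim (from (affine c c) refl)
    go infinite     infinite     _ _    = refl

  -- The lines through a point are parametrised by slope at an affine point, by intercept at a
  -- direction and by abscissa at the apex. The label `zero` is left for the one further line,
  -- vertical or infinite.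
  pencilLabel : Point → Line → Fin (suc q)
  pencilLabel (direction _) (slope m b)  = suc b
  pencilLabel _             (slope m b)  = suc m
  pencilLabel apex          (vertical c) = suc c
  pencilLabel _             (vertical c) = zero
  pencilLabel _             infinite     = zero

  pencilLabel-injective : ∀ P {l l′} → Incident P l → Incident P l′ → pencilLabel P l ≡ pencilLabel P l′ → l ≡ l′
  pencilLabel-injective (affine x y) {slope m b}  {slope m b′} eq   eq′  refl = cong (slope m) (injective m x (trans (sym eq) eq′))
  pencilLabel-injective (affine x y) {slope m b}  {vertical c} _    _    ()
  pencilLabel-injective (affine x y) {vertical c} {slope m b}  _    _    ()
  pencilLabel-injective (affine x y) {vertical c} {vertical d} refl refl _    = refl
  pencilLabel-injective (direction d) {slope m b} {slope m′ b} refl refl refl = refl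
  pencilLabel-injective (direction d) {slope m b} {infinite}   _    _    ()
  pencilLabel-injective (direction d) {infinite}  {slope m b}  _    _    ()
  pencilLabel-injective (direction d) {infinite}  {infinite}   _    _    _    = refl
  pencilLabel-injective apex {vertical c} {vertical c} _ _ refl = refl
  pencilLabel-injective apex {vertical c} {infinite}   _ _ ()
  pencilLabel-injective apex {infinite}   {vertical c} _ _ ()
  pencilLabel-injective apex {infinite}   {infinite}   _ _ _    = refl

  allLines : List Line
  allLines = cartesianProductWith slope (allFin q) (allFin q) List.++ infinite ∷ map vertical (allFin q)

  allLines-unique : Unique allLines
  allLines-unique = Unique.++⁺
    (Unique.cartesianProductWith⁺ slope (λ { refl → refl , refl }) (Unique.allFin⁺ q) (Unique.allFin⁺ q))
    (All.map⁺ (All.universal (λ _ ()) (allFin q)) ∷ Unique.map⁺ (λ { refl → refl }) (Unique.allFin⁺ q))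
    (λ (l∈₁ , l∈₂) → disjoint l∈₁ l∈₂)
    where
    disjoint : ∀ {l} → l ListMem.∈ cartesianProductWith slope (allFin q) (allFin q) →
               ¬ l ListMem.∈ (infinite ∷ map vertical (allFin q))
    disjoint l∈₁ l∈₂ with ListMem.∈-cartesianProductWith⁻ slope (allFin q) (allFin q) l∈₁
    disjoint l∈₁ (Any.there l∈₂) | m , b , _ , _ , refl with ListMem.∈-map⁻ vertical l∈₂
    ... | _ , _ , ()

  plane : Plane q
  plane = record
    { order    = q * q + suc q
    ; lines    = map points allLines
    ; unique   = Unique.map⁺ points-injective allLines-unique
    ; sizes    = All.map⁺ (All.universal ∣points∣ allLines)
    ; meeting  = meeting
    ; count    = trans (List.length-map points allLines) (trans
        (List.length-++ (cartesianProductWith slope (allFin q) (allFin q)))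
        (cong₂ _+_ (trans (length-cartesianProductWith slope (allFin q) (allFin q)) (cong₂ _*_ (length-allFin q) (length-allFin q)))
                   (cong suc (trans (List.length-map vertical (allFin q)) (length-allFin q)))))
    ; degree≤  = degree≤
    }
    where
    meeting : ∀ {L M} → L ListMem.∈ map points allLines → M ListMem.∈ map points allLines → Nonempty (L ∩ M)
    meeting L∈ M∈ with ListMem.∈-map⁻ points L∈ | ListMem.∈-map⁻ points M∈
    ... | l , _ , refl | l′ , _ , refl = let P , P∈l , P∈l′ = meet-lines l l′ in
      encode P , Subset.x∈p∩q⁺ (∈-points⁺ P l P∈l , ∈-points⁺ P l′ P∈l′)
    degree≤ : ∀ z → deg z (map points allLines) ≤ suc q
    degree≤ z with decode z
    ... | P , refl = ℕ.≤-trans (ℕ.≤-reflexive (length-filter-map (encode P ∈?_) points allLines))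
      (labelling⇒length≤ (Unique.filter⁺ P∈? allLines-unique) (pencilLabel P)
        (λ l∈ l′∈ → pencilLabel-injective P (incident l∈) (incident l′∈)))
      where
      P∈? = λ l → encode P ∈? points l
      incident : ∀ {l} → l ListMem.∈ filter P∈? allLines → Incident P l
      incident {l} l∈ = ∈-points⁻ P l (proj₂ (ListMem.∈-filter⁻ P∈? {xs = allLines} l∈))

-- Products of set families

infixr 7 _⊗_
_⊗_ : ∀ {m n} → List (Subset m) → List (Subset n) → List (Subset (m + n))
_⊗_ = cartesianProductWith _++_

⊗-unique : ∀ {m n} {L : List (Subset m)} {M : List (Subset n)} → Unique L → Unique M → Unique (L ⊗ M)
⊗-unique = Unique.cartesianProductWith⁺ _++_ λ {A} {A′} → Vec.++-injective A A′

⊗-uniform : ∀ {m n a b} {L : List (Subset m)} {M : List (Subset n)} →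
  All (λ A → ∣ A ∣ ≡ a) L → All (λ B → ∣ B ∣ ≡ b) M → All (λ A → ∣ A ∣ ≡ a + b) (L ⊗ M)
⊗-uniform {L = L} {M} ∣L∣ ∣M∣ = All.tabulate λ A∈ → go A∈
  where
  go : ∀ {A} → A ListMem.∈ L ⊗ M → ∣ A ∣ ≡ _
  go A∈ with ListMem.∈-cartesianProductWith⁻ _++_ L M A∈
  ... | A , B , A∈L , B∈M , refl = trans (∣++∣ A B) (cong₂ _+_ (All.lookup ∣L∣ A∈L) (All.lookup ∣M∣ B∈M))

deg-++ : ∀ {n} (x : Fin n) L M → deg x (L List.++ M) ≡ deg x L + deg x M
deg-++ x L M = trans (cong length (List.filter-++ (x ∈?_) L M)) (List.length-++ (filter (x ∈?_) L))

deg-⊗ˡ : ∀ {m n} (x : Fin m) L (M : List (Subset n)) → deg (x ↑ˡ n) (L ⊗ M) ≡ deg x L * length M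
deg-⊗ˡ x []      M = refl
deg-⊗ˡ {m} {n} x (A ∷ L) M with deg-++ (x ↑ˡ n) (map (A ++_) M) (L ⊗ M) | x ∈? A
... | eq | yes x∈A = trans eq (cong₂ _+_ (trans (length-filter-map (x ↑ˡ n ∈?_) (A ++_) M)
      (cong length (List.filter-all _ (All.universal (λ B → ∈-++ˡ B x∈A) M)))) (deg-⊗ˡ x L M))
... | eq | no  x∉A = trans eq (cong₂ _+_ (trans (length-filter-map (x ↑ˡ n ∈?_) (A ++_) M)
      (cong length (List.filter-none _ (All.universal (λ B → x∉A ∘ ∈-++⁻ˡ A B) M)))) (deg-⊗ˡ x L M))

deg-⊗ʳ : ∀ {m n} (y : Fin n) (L : List (Subset m)) M → deg (m ↑ʳ y) (L ⊗ M) ≡ length L * deg y M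
deg-⊗ʳ y []      M = refl
deg-⊗ʳ {m} y (A ∷ L) M = trans (deg-++ (m ↑ʳ y) (map (A ++_) M) (L ⊗ M)) (cong₂ _+_
  (trans (length-filter-map (m ↑ʳ y ∈?_) (A ++_) M)
         (cong length (List.filter-≐ (λ B → m ↑ʳ y ∈? (A ++ B)) (y ∈?_) ((λ {B} → ∈-++⁻ʳ A B) , ∈-++ʳ A) M)))
  (deg-⊗ʳ y L M))

singletons : ∀ m → List (Subset m)
singletons m = map ⁅_⁆ (allFin m)

⁅⁆-injective : ∀ {m} {i j : Fin m} → ⁅ i ⁆ ≡ ⁅ j ⁆ → i ≡ j
⁅⁆-injective {i = i} {j} eq = Subset.x∈⁅y⁆⇒x≡y j (subst (i ∈_) eq (Subset.x∈⁅x⁆ i))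

deg-singletons : ∀ {m} (x : Fin m) → deg x (singletons m) ≤ 1
deg-singletons {m} x = ℕ.≤-trans (ℕ.≤-reflexive (length-filter-map (x ∈?_) ⁅_⁆ (allFin m)))
  (labelling⇒length≤ (Unique.filter⁺ x∈? (Unique.allFin⁺ m)) (λ _ → zero {0})
    (λ i∈ j∈ _ → trans (sym (x≡ i∈)) (x≡ j∈)))
  where
  x∈? = λ i → x ∈? ⁅ i ⁆
  x≡ : ∀ {i} → i ListMem.∈ filter x∈? (allFin m) → x ≡ i
  x≡ {i} i∈ = Subset.x∈⁅y⁆⇒x≡y i (proj₂ (ListMem.∈-filter⁻ x∈? {xs = allFin m} i∈))

-- s consecutive blocks of length m, followed by t unused points.
dim : ℕ → ℕ → ℕ → ℕ
dim zero    m t = t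
dim (suc s) m t = m + dim s m t

dim≡ : ∀ s m t → dim s m t ≡ s * m + t
dim≡ zero    m t = refl
dim≡ (suc s) m t = trans (cong (m +_) (dim≡ s m t)) (sym (ℕ.+-assoc m (s * m) t))

transversals : ∀ s m t → List (Subset (dim s m t))
transversals zero    m t = Subset.⊥ ∷ []
transversals (suc s) m t = singletons m ⊗ transversals s m t

transversals-unique : ∀ s m t → Unique (transversals s m t)
transversals-unique zero    m t = [] ∷ []
transversals-unique (suc s) m t = ⊗-unique (Unique.map⁺ ⁅⁆-injective (Unique.allFin⁺ m)) (transversals-unique s m t)

transversals-uniform : ∀ s m t → All (λ A → ∣ A ∣ ≡ s) (transversals s m t)
transversals-uniform zero    m t = Subset.∣⊥∣≡0 t ∷ []
transversals-uniform (suc s) m t = ⊗-uniform (All.map⁺ (All.universal Subset.∣⁅x⁆∣≡1 (allFin m))) (transversals-uniform s m t)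

length-⊗ : ∀ {m n} (L : List (Subset m)) (M : List (Subset n)) → length (L ⊗ M) ≡ length L * length M
length-⊗ = length-cartesianProductWith _++_

length-singletons : ∀ m → length (singletons m) ≡ m
length-singletons m = trans (List.length-map ⁅_⁆ (allFin m)) (length-allFin m)

length-transversals : ∀ s m t → length (transversals s m t) ≡ m ^ s
length-transversals zero    m t = refl
length-transversals (suc s) m t = trans (length-⊗ (singletons m) (transversals s m t))
  (cong₂ _*_ (length-singletons m) (length-transversals s m t))

deg-transversals : ∀ s m t x → m * deg x (transversals s m t) ≤ m ^ s
deg-transversals zero m t x = ℕ.≤-trans (ℕ.≤-reflexive (trans (cong ((m *_) ∘ length)
  (List.filter-none (x ∈?_) (Subset.∉⊥ ∷ []))) (ℕ.*-zeroʳ m))) z≤n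
deg-transversals (suc s) m t z with split m (dim s m t) z
... | left x  = ℕ.*-monoʳ-≤ m (begin
  deg (x ↑ˡ dim s m t) (singletons m ⊗ transversals s m t)   ≡⟨ deg-⊗ˡ x (singletons m) _ ⟩
  deg x (singletons m) * length (transversals s m t)         ≤⟨ ℕ.*-monoˡ-≤ _ (deg-singletons x) ⟩
  1 * length (transversals s m t)                            ≡⟨ trans (ℕ.*-identityˡ _) (length-transversals s m t) ⟩
  m ^ s                                                      ∎)
  where open ℕ.≤-Reasoning
... | right y = ℕ.*-monoʳ-≤ m (begin
  deg (m ↑ʳ y) (singletons m ⊗ transversals s m t)           ≡⟨ deg-⊗ʳ y (singletons m) _ ⟩
  length (singletons m) * deg y (transversals s m t)         ≡⟨ cong (_* deg y (transversals s m t)) (length-singletons m) ⟩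
  m * deg y (transversals s m t)                             ≤⟨ deg-transversals s m t y ⟩
  m ^ s                                                      ∎)
  where open ℕ.≤-Reasoning

module _ {q : ℕ} (𝒫 : Plane q) where
  open Plane 𝒫

  -- A point of a block lies in at most `length lines` times m ^ (s - 1) sets. Blocks at least as
  -- long as the number of lines keep this below m ^ s, hence below the bound for points of the
  -- plane.
  deg-lines⊗transversals : ∀ s m t → length lines ≤ m →
    ∀ z → deg z (lines ⊗ transversals s m t) ≤ suc q * m ^ s
  deg-lines⊗transversals s m t ∣lines∣≤m z with split order (dim s m t) z
  ... | left x = begin
    deg (x ↑ˡ dim s m t) (lines ⊗ transversals s m t)    ≡⟨ deg-⊗ˡ x lines _ ⟩
    deg x lines * length (transversals s m t)            ≡⟨ cong (deg x lines *_) (length-transversals s m t) ⟩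
    deg x lines * m ^ s                                  ≤⟨ ℕ.*-monoˡ-≤ (m ^ s) (degree≤ x) ⟩
    suc q * m ^ s                                        ∎
    where open ℕ.≤-Reasoning
  ... | right y = begin
    deg (order ↑ʳ y) (lines ⊗ transversals s m t)        ≡⟨ deg-⊗ʳ y lines _ ⟩
    length lines * deg y (transversals s m t)            ≤⟨ ℕ.*-monoˡ-≤ _ ∣lines∣≤m ⟩
    m * deg y (transversals s m t)                       ≤⟨ deg-transversals s m t y ⟩
    m ^ s                                                ≤⟨ ℕ.m≤n*m (m ^ s) (suc q) ⟩
    suc q * m ^ s                                        ∎
    where open ℕ.≤-Reasoning

-- Transversals of intersecting families

elements : ∀ {n} → Subset n → List (Fin n)
elements []            = []
elements (inside  ∷ A) = zero ∷ map suc (elements A)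
elements (outside ∷ A) = map suc (elements A)

length-elements : ∀ {n} (A : Subset n) → length (elements A) ≡ ∣ A ∣
length-elements []            = refl
length-elements (inside  ∷ A) = cong suc (trans (List.length-map Fin.suc (elements A)) (length-elements A))
length-elements (outside ∷ A) = trans (List.length-map Fin.suc (elements A)) (length-elements A)

∈-elements⁺ : ∀ {n} {A : Subset n} {x} → x ∈ A → x ListMem.∈ elements A
∈-elements⁺ {A = inside  ∷ A} here        = here refl
∈-elements⁺ {A = inside  ∷ A} (there x∈A) = there (ListMem.∈-map⁺ suc (∈-elements⁺ x∈A))
∈-elements⁺ {A = outside ∷ A} (there x∈A) = ListMem.∈-map⁺ suc (∈-elements⁺ x∈A)

∈-elements⁻ : ∀ {n} (A : Subset n) {x} → x ListMem.∈ elements A → x ∈ A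
∈-elements⁻ (inside  ∷ A) (here refl) = here
∈-elements⁻ (inside  ∷ A) (there x∈) with ListMem.∈-map⁻ suc x∈
... | _ , y∈ , refl = there (∈-elements⁻ A y∈)
∈-elements⁻ (outside ∷ A) x∈ with ListMem.∈-map⁻ suc x∈
... | _ , y∈ , refl = there (∈-elements⁻ A y∈)

module _ {A : Set} {P Q R : A → Set} (P? : Decidable P) (Q? : Decidable Q) (R? : Decidable R) where

  length-filter-filter : (∀ {x} → P x → Q x → R x) → ∀ xs →
                         length (filter Q? (filter P? xs)) ≤ length (filter R? xs)
  length-filter-filter PQ⇒R []       = z≤n
  length-filter-filter PQ⇒R (x ∷ xs) with P? x | R? x
  ... | no  _ | no  _ = length-filter-filter PQ⇒R xs
  ... | no  _ | yes _ = ℕ.m≤n⇒m≤1+n (length-filter-filter PQ⇒R xs)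
  ... | yes p | r? with Q? x | r?
  ... | no  _ | no  _  = length-filter-filter PQ⇒R xs
  ... | no  _ | yes _  = ℕ.m≤n⇒m≤1+n (length-filter-filter PQ⇒R xs)
  ... | yes q | yes _  = s≤s (length-filter-filter PQ⇒R xs)
  ... | yes q | no ¬r  = ⊥-elim (¬r (PQ⇒R p q))

length-filter-¬ : ∀ {A : Set} {P : A → Set} (P? : Decidable P) xs →
                  length xs ≡ length (filter P? xs) + length (filter (¬? ∘ P?) xs)
length-filter-¬ P? []       = refl
length-filter-¬ P? (x ∷ xs) with P? x
... | yes _ = cong suc (length-filter-¬ P? xs)
... | no  _ = trans (cong suc (length-filter-¬ P? xs)) (sym (ℕ.+-suc _ _))

Covers : ∀ {n} → List (Fin n) → List (Subset n) → Set
Covers X L = All (λ A → Any (_∈ A) X) L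

-- Split off the members through the first point; the others are covered by the remaining points,
-- and their degrees can only be smaller.
covers⇒length≤ : ∀ {n b} (X : List (Fin n)) {L} → Covers X L → (∀ {x} → x ListMem.∈ X → deg x L ≤ b) →
                 length L ≤ length X * b
covers⇒length≤ []      []       deg≤b = z≤n
covers⇒length≤ []      (() ∷ _) deg≤b
covers⇒length≤ (x ∷ X) {L} cov deg≤b = ℕ.≤-trans (ℕ.≤-reflexive (length-filter-¬ (x ∈?_) L))
  (ℕ.+-mono-≤ (deg≤b (here refl)) (covers⇒length≤ X cov′ λ {y} y∈X →
    ℕ.≤-trans (length-filter-filter (¬? ∘ (x ∈?_)) (y ∈?_) (y ∈?_) (λ _ → id) L) (deg≤b (there y∈X))))
  where
  cov′ : Covers X (filter (¬? ∘ (x ∈?_)) L)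
  cov′ = All.tabulate λ A∈ → let A∈L , x∉A = ListMem.∈-filter⁻ (¬? ∘ (x ∈?_)) {xs = L} A∈ in
    Any.tail x∉A (All.lookup cov A∈L)

∣∪⁅⁆∣ : ∀ {n} (T : Subset n) {x} → x ∉ T → ∣ T ∪ ⁅ x ⁆ ∣ ≡ suc ∣ T ∣
∣∪⁅⁆∣ (inside  ∷ T) {zero}  x∉T = ⊥-elim (x∉T here)
∣∪⁅⁆∣ (outside ∷ T) {zero}  x∉T = cong (suc ∘ ∣_∣) (Subset.∪-identityʳ T)
∣∪⁅⁆∣ (inside  ∷ T) {suc x} x∉T = cong suc (∣∪⁅⁆∣ T (x∉T ∘ there))
∣∪⁅⁆∣ (outside ∷ T) {suc x} x∉T = ∣∪⁅⁆∣ T (x∉T ∘ there)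

∪⁅⁆-⊆ : ∀ {n} {T A : Subset n} {x} → T ⊆ A → x ∈ A → T ∪ ⁅ x ⁆ ⊆ A
∪⁅⁆-⊆ {T = T} {x = x} T⊆A x∈A y∈ with Subset.x∈p∪q⁻ T ⁅ x ⁆ y∈
... | inj₁ y∈T = T⊆A y∈T
... | inj₂ y∈x rewrite Subset.x∈⁅y⁆⇒x≡y x y∈x = x∈A

⊈⇒∃∈∉ : ∀ {n} (A T : Subset n) → ¬ A ⊆ T → ∃ λ x → x ∈ A × x ∉ T
⊈⇒∃∈∉ A T A⊈T = decidable-stable (Fin.any? λ x → (x ∈? A) ×-dec ¬? (x ∈? T))
  λ none → A⊈T λ {x} x∈A → decidable-stable (x ∈? T) λ x∉T → none (x , x∈A , x∉T)

⊆∧∣≡∣⇒≡ : ∀ {n} {T A : Subset n} → T ⊆ A → ∣ A ∣ ≡ ∣ T ∣ → A ≡ T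
⊆∧∣≡∣⇒≡ {T = T} {A} T⊆A ∣A∣≡∣T∣ with A ⊆? T
... | yes A⊆T = Subset.⊆-antisym A⊆T T⊆A
... | no  A⊈T = let x , x∈A , x∉T = ⊈⇒∃∈∉ A T A⊈T in
  ⊥-elim (ℕ.1+n≰n (subst₂ _≤_ (∣∪⁅⁆∣ T x∉T) ∣A∣≡∣T∣ (Subset.p⊆q⇒∣p∣≤∣q∣ (∪⁅⁆-⊆ T⊆A x∈A))))

-- The `k` points outside `T` are chosen one at a time, with at most `n` options each. A set is
-- counted once for each order of these points, which costs only a constant factor.
star≤ : ∀ {n} k (T : Subset n) {L} → Unique L → All (T ⊆_) L → All (λ A → ∣ A ∣ ≡ k + ∣ T ∣) L →
        length L ≤ n ^ k
star≤ zero    T {L} uniq T⊆ sizes = labelling⇒length≤ uniq (λ _ → zero) λ A∈ B∈ _ → trans (≡T A∈) (sym (≡T B∈))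
  where
  ≡T : ∀ {A} → A ListMem.∈ L → A ≡ T
  ≡T A∈ = ⊆∧∣≡∣⇒≡ (All.lookup T⊆ A∈) (All.lookup sizes A∈)
star≤ {n} (suc k) T {L} uniq T⊆ sizes = ℕ.≤-trans
  (covers⇒length≤ (elements (∁ T)) covers λ {x} x∈ → star≤ k (T ∪ ⁅ x ⁆) (Unique.filter⁺ (x ∈?_) uniq)
    (All.tabulate λ A∈ → let A∈L , x∈A = ListMem.∈-filter⁻ (x ∈?_) {xs = L} A∈ in ∪⁅⁆-⊆ (All.lookup T⊆ A∈L) x∈A)
    (All.tabulate λ A∈ → trans (All.lookup sizes (proj₁ (ListMem.∈-filter⁻ (x ∈?_) {xs = L} A∈)))
      (trans (sym (ℕ.+-suc k ∣ T ∣)) (cong (k +_) (sym (∣∪⁅⁆∣ T (Subset.x∈∁p⇒x∉p (∈-elements⁻ (∁ T) x∈))))))))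
  (ℕ.*-monoˡ-≤ (n ^ k) (ℕ.≤-trans (ℕ.≤-reflexive (length-elements (∁ T))) (Subset.∣p∣≤n (∁ T))))
  where
  ⊈T : ∀ {A} → ∣ A ∣ ≡ suc k + ∣ T ∣ → ¬ A ⊆ T
  ⊈T ∣A∣ A⊆T = ℕ.<⇒≱ (s≤s (ℕ.m≤n+m ∣ T ∣ k)) (subst (_≤ ∣ T ∣) ∣A∣ (Subset.p⊆q⇒∣p∣≤∣q∣ A⊆T))
  covers : Covers (elements (∁ T)) L
  covers = All.map (λ {A} ∣A∣ → let x , x∈A , x∉T = ⊈⇒∃∈∉ A T (⊈T ∣A∣) in
    Any.map (λ { refl → x∈A }) (∈-elements⁺ (Subset.x∉p⇒x∈∁p x∉T))) sizes

traverse⊎ : ∀ {A P : Set} {Q : A → Set} (xs : List A) → (∀ {x} → x ListMem.∈ xs → P ⊎ Q x) → P ⊎ All Q xs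
traverse⊎ []       f = inj₂ []
traverse⊎ (x ∷ xs) f with f (here refl) | traverse⊎ xs (f ∘ there)
... | inj₁ p | _       = inj₁ p
... | inj₂ _ | inj₁ p  = inj₁ p
... | inj₂ q | inj₂ qs = inj₂ (q ∷ qs)

module _ {n r : ℕ} (F : Family n r) (int : Intersecting F) (q : ℕ) (q<r : q < r) where

  SmallCover : Set
  SmallCover = ∃ λ X → length X ≤ q × Covers X (members F)

  private e = r ∸ q ∸ 1

  e+1+q≡r : e + suc q ≡ r
  e+1+q≡r = trans (cong (_+ suc q) (trans (ℕ.∸-+-assoc r q 1) (cong (r ∸_) (ℕ.+-comm q 1)))) (ℕ.m∸n+n≡m q<r)

  -- Branching: if T is not a cover, some member B misses T, and every member containing T contains T ∪ {x} for an x ∈ B.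
  branch : ∀ j (T : Subset n) → j + ∣ T ∣ ≡ suc q →
           SmallCover ⊎ length (filter (T ⊆?_) (members F)) ≤ r ^ j * n ^ e
  branch zero T ∣T∣≡1+q = inj₂ (ℕ.≤-trans
    (star≤ e T (Unique.filter⁺ (T ⊆?_) (distinct F)) (All.tabulate λ A∈ → proj₂ (ListMem.∈-filter⁻ (T ⊆?_) {xs = members F} A∈))
      (All.tabulate λ A∈ → trans (All.lookup (uniform F) (proj₁ (ListMem.∈-filter⁻ (T ⊆?_) {xs = members F} A∈)))
        (sym (trans (cong (e +_) ∣T∣≡1+q) e+1+q≡r))))
    (ℕ.≤-reflexive (sym (ℕ.*-identityˡ (n ^ e)))))
  branch (suc j) T j+∣T∣≡q with All.all? (λ A → nonempty? (A ∩ T)) (members F)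
  -- At this level `j + ∣ T ∣` equals `q`, so a `T` that meets every member is a cover by at most
  -- `q` points.
  ... | yes meets = inj₁ (elements T , ∣T∣≤q , All.map met meets)
    where
    ∣T∣≤q : length (elements T) ≤ q
    ∣T∣≤q = ℕ.≤-trans (ℕ.≤-reflexive (length-elements T))
              (ℕ.≤-trans (ℕ.m≤n+m ∣ T ∣ j) (ℕ.≤-reflexive (ℕ.suc-injective j+∣T∣≡q)))
    met : ∀ {A} → Nonempty (A ∩ T) → Any (_∈ A) (elements T)
    met {A} (x , x∈) = let x∈A , x∈T = Subset.x∈p∩q⁻ A T x∈ in Any.map (λ { refl → x∈A }) (∈-elements⁺ x∈T)
  ... | no ¬meets with ListMem.find (All.¬All⇒Any¬ (λ A → nonempty? (A ∩ T)) (members F) ¬meets)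
  ... | B , B∈F , B∩T≡∅ = Sum.map₂ bound (traverse⊎ (elements B) step)
    where
    step : ∀ {x} → x ListMem.∈ elements B →
           SmallCover ⊎ length (filter (T ∪ ⁅ x ⁆ ⊆?_) (members F)) ≤ r ^ j * n ^ e
    step {x} x∈B = branch j (T ∪ ⁅ x ⁆) (trans (cong (j +_) (∣∪⁅⁆∣ T x∉T)) (trans (ℕ.+-suc j ∣ T ∣) j+∣T∣≡q))
      where
      x∉T : x ∉ T
      x∉T x∈T = B∩T≡∅ (x , Subset.x∈p∩q⁺ (∈-elements⁻ B x∈B , x∈T))
    bound : All (λ x → length (filter (T ∪ ⁅ x ⁆ ⊆?_) (members F)) ≤ r ^ j * n ^ e) (elements B) →
            length (filter (T ⊆?_) (members F)) ≤ r * r ^ j * n ^ e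
    bound bounds = ℕ.≤-trans
      (covers⇒length≤ (elements B) covers λ {x} x∈ →
        ℕ.≤-trans (length-filter-filter (T ⊆?_) (x ∈?_) (T ∪ ⁅ x ⁆ ⊆?_) ∪⁅⁆-⊆ (members F)) (All.lookup bounds x∈))
      (ℕ.≤-reflexive (trans (cong (_* (r ^ j * n ^ e)) (trans (length-elements B) (All.lookup (uniform F) B∈F)))
        (sym (ℕ.*-assoc r (r ^ j) (n ^ e)))))
      where
      covers : Covers (elements B) (filter (T ⊆?_) (members F))
      covers = All.tabulate λ {A} A∈ →
        let x , x∈ = int (proj₁ (ListMem.∈-filter⁻ (T ⊆?_) {xs = members F} A∈)) B∈F
            x∈A , x∈B = Subset.x∈p∩q⁻ A B x∈
        in Any.map (λ { refl → x∈A }) (∈-elements⁺ x∈B)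

  degree≤Δ : ∀ x → degree F x ≤ Δ F
  degree≤Δ x = go (ListMem.∈-map⁺ (degree F) (ListMem.∈-allFin x))
    where
    go : ∀ {d ds} → d ListMem.∈ ds → d ≤ foldr _⊔_ 0 ds
    go {ds = d ∷ ds} (here refl) = ℕ.m≤m⊔n d _
    go {ds = d ∷ ds} (there d∈)  = ℕ.≤-trans (go d∈) (ℕ.m≤n⊔m d _)

  size-dichotomy : size F ≤ q * Δ F ⊎ size F ≤ r ^ suc q * n ^ e
  size-dichotomy with branch (suc q) Subset.⊥ (trans (cong (suc q +_) (Subset.∣⊥∣≡0 n)) (ℕ.+-identityʳ (suc q)))
  ... | inj₁ (X , ∣X∣≤q , cov) = inj₁ (ℕ.≤-trans (covers⇒length≤ X cov λ {x} _ → degree≤Δ x) (ℕ.*-monoˡ-≤ (Δ F) ∣X∣≤q))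
  ... | inj₂ size≤ = inj₂ (ℕ.≤-trans (ℕ.≤-reflexive (cong length (sym (List.filter-all (Subset.⊥ ⊆?_)
        (All.universal (λ A {x} x∈⊥ → ⊥-elim (Subset.∉⊥ x∈⊥)) (members F)))))) size≤)

-- Weighted diversity

fromℚᵘ-homo-* : ∀ x y → fromℚᵘ (x ℚᵘ.* y) ≡ fromℚᵘ x ℚ.* fromℚᵘ y
fromℚᵘ-homo-* x y = ℚ.toℚᵘ-injective (ℚᵘ.≃-trans (ℚ.toℚᵘ-fromℚᵘ (x ℚᵘ.* y)) (ℚᵘ.≃-sym
  (ℚᵘ.≃-trans (ℚ.toℚᵘ-homo-* (fromℚᵘ x) (fromℚᵘ y)) (ℚᵘ.*-cong (ℚ.toℚᵘ-fromℚᵘ x) (ℚ.toℚᵘ-fromℚᵘ y)))))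

fromℚᵘ-mono-≤ : ∀ {x y} → x ℚᵘ.≤ y → fromℚᵘ x ℚ.≤ fromℚᵘ y
fromℚᵘ-mono-≤ {x} {y} x≤y = ℚ.toℚᵘ-cancel-≤ (ℚᵘ.≤-respʳ-≃ (ℚᵘ.≃-sym (ℚ.toℚᵘ-fromℚᵘ y))
  (ℚᵘ.≤-respˡ-≃ (ℚᵘ.≃-sym (ℚ.toℚᵘ-fromℚᵘ x)) x≤y))

ℕ→ℚ-homo-* : ∀ a b → ℕ→ℚ (a * b) ≡ ℕ→ℚ a ℚ.* ℕ→ℚ b
ℕ→ℚ-homo-* a b = trans (ℚ.fromℚᵘ-cong {mkℚᵘ (ℤ.+ (a * b)) 0} {mkℚᵘ (ℤ.+ a) 0 ℚᵘ.* mkℚᵘ (ℤ.+ b) 0}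
  (*≡* (cong (ℤ._* (ℤ.+ 1)) (ℤ.pos-* a b)))) (fromℚᵘ-homo-* (mkℚᵘ (ℤ.+ a) 0) (mkℚᵘ (ℤ.+ b) 0))

ℕ→ℚ-mono-≤ : ∀ {a b} → a ≤ b → ℕ→ℚ a ℚ.≤ ℕ→ℚ b
ℕ→ℚ-mono-≤ {a} {b} a≤b = fromℚᵘ-mono-≤ {mkℚᵘ (ℤ.+ a) 0} {mkℚᵘ (ℤ.+ b) 0} (*≤* (ℤ.*-monoʳ-≤-nonNeg (ℤ.+ 1) (ℤ.+≤+ a≤b)))

ℕ→ℚ-nonNegative : ∀ a → ℚ.NonNegative (ℕ→ℚ a)
ℕ→ℚ-nonNegative a = ℚ.normalize-nonNeg a 1

ℕ→ℚ-positive : ∀ a .{{_ : NonZero a}} → ℚ.Positive (ℕ→ℚ a)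
ℕ→ℚ-positive a = ℚ.normalize-pos a 1

threshold-* : ∀ q → threshold q ℚ.* ℕ→ℚ (suc q) ≡ ℕ→ℚ (q * q + q + 1)
threshold-* q = trans (sym (fromℚᵘ-homo-* (mkℚᵘ (ℤ.+ s) q) (mkℚᵘ (ℤ.+ suc q) 0)))
  (ℚ.fromℚᵘ-cong {mkℚᵘ (ℤ.+ s) q ℚᵘ.* mkℚᵘ (ℤ.+ suc q) 0} {mkℚᵘ (ℤ.+ s) 0} (*≡* (begin
    (ℤ.+ s ℤ.* ℤ.+ suc q) ℤ.* (ℤ.+ 1)   ≡⟨ ℤ.*-identityʳ _ ⟩
    ℤ.+ s ℤ.* ℤ.+ suc q               ≡⟨ cong (λ z → ℤ.+ s ℤ.* ℤ.+ suc z) (ℕ.*-identityʳ q) ⟨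
    ℤ.+ s ℤ.* ℤ.+ suc (q * 1)         ∎)))
  where
  open ≡-Reasoning
  s = q * q + q + 1

-- Multiplied by `q + 1`, this is `q² + q ≤ q² + q + 1`.
ℕ→ℚ≤threshold : ∀ q → ℕ→ℚ q ℚ.≤ threshold q
ℕ→ℚ≤threshold q = ℚ.*-cancelʳ-≤-pos (ℕ→ℚ (suc q)) {{ℕ→ℚ-positive (suc q)}} (subst₂ ℚ._≤_
  (ℕ→ℚ-homo-* q (suc q)) (sym (threshold-* q)) (ℕ→ℚ-mono-≤ (ℕ.≤-trans (ℕ.≤-reflexive
    (trans (ℕ.*-suc q q) (ℕ.+-comm q (q * q)))) (ℕ.m≤m+n (q * q + q) 1))))

p≤q⇒p-q≤0 : ∀ {p q} → p ℚ.≤ q → p ℚ.- q ℚ.≤ ℚ.0ℚ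
p≤q⇒p-q≤0 {p} {q} p≤q = ℚ.≤-trans (ℚ.+-monoˡ-≤ (ℚ.- q) p≤q) (ℚ.≤-reflexive (ℚ.+-inverseʳ q))

upperBound : ∀ r C q → q < r → threshold q ℚ.≤ C → DIsBigO C r (r ∸ q ∸ 1)
upperBound r C q q<r threshold≤C = ℕ→ℚ K , 0 , λ n _ F int → bound n F (size-dichotomy F int q q<r)
  where
  K = r ^ suc q
  e = r ∸ q ∸ 1
  q≤C = ℚ.≤-trans (ℕ→ℚ≤threshold q) threshold≤C
  instance
    -- Follows from `0 ≤ q ≤ C`. It allows the term with `Δ` to be dropped when the family has no
    -- small cover.
    C≥0 : ℚ.NonNegative C
    C≥0 = ℚ.nonNegative (ℚ.≤-trans (ℚ.nonNegative⁻¹ _ {{ℕ→ℚ-nonNegative q}}) q≤C)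
  open ℚ.≤-Reasoning
  bound : ∀ n (F : Family n r) → size F ≤ q * Δ F ⊎ size F ≤ K * n ^ e → d C F ℚ.≤ ℕ→ℚ K ℚ.* ℕ→ℚ (n ^ e)
  bound n F (inj₁ size≤) = begin
    d C F                     ≤⟨ p≤q⇒p-q≤0 (begin
      ℕ→ℚ (size F)              ≤⟨ ℕ→ℚ-mono-≤ size≤ ⟩
      ℕ→ℚ (q * Δ F)             ≡⟨ ℕ→ℚ-homo-* q (Δ F) ⟩
      ℕ→ℚ q ℚ.* ℕ→ℚ (Δ F)       ≤⟨ ℚ.*-monoʳ-≤-nonNeg (ℕ→ℚ (Δ F)) {{ℕ→ℚ-nonNegative (Δ F)}} q≤C ⟩
      C ℚ.* ℕ→ℚ (Δ F)           ∎) ⟩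
    ℚ.0ℚ                      ≤⟨ ℚ.nonNegative⁻¹ _ {{ℕ→ℚ-nonNegative (K * n ^ e)}} ⟩
    ℕ→ℚ (K * n ^ e)           ≡⟨ ℕ→ℚ-homo-* K (n ^ e) ⟩
    ℕ→ℚ K ℚ.* ℕ→ℚ (n ^ e)     ∎
  bound n F (inj₂ size≤) = begin
    d C F                     ≤⟨ ℚ.+-monoʳ-≤ (ℕ→ℚ (size F)) (ℚ.neg-antimono-≤ (ℚ.nonNegative⁻¹ (C ℚ.* ℕ→ℚ (Δ F))
                                   {{ℚ.nonNeg*nonNeg⇒nonNeg C (ℕ→ℚ (Δ F)) {{ℕ→ℚ-nonNegative (Δ F)}}}})) ⟩
    ℕ→ℚ (size F) ℚ.- ℚ.0ℚ     ≡⟨ ℚ.+-identityʳ _ ⟩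
    ℕ→ℚ (size F)              ≤⟨ ℕ→ℚ-mono-≤ size≤ ⟩
    ℕ→ℚ (K * n ^ e)           ≡⟨ ℕ→ℚ-homo-* K (n ^ e) ⟩
    ℕ→ℚ K ℚ.* ℕ→ℚ (n ^ e)     ∎

-- Large intersecting families from a projective plane

module _ {p : ℕ} (𝒫 : Plane p) where
  open Plane 𝒫

  planeFamily : ∀ s m t → Family (order + dim s m t) (suc p + s)
  planeFamily s m t = record
    { members  = lines ⊗ transversals s m t
    ; distinct = ⊗-unique unique (transversals-unique s m t)
    ; uniform  = ⊗-uniform sizes (transversals-uniform s m t)
    }

  planeFamily-intersecting : ∀ s m t → Intersecting (planeFamily s m t)
  planeFamily-intersecting s m t A∈ B∈
    with ListMem.∈-cartesianProductWith⁻ _++_ lines (transversals s m t) A∈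
       | ListMem.∈-cartesianProductWith⁻ _++_ lines (transversals s m t) B∈
  ... | L , S , L∈ , _ , refl | M , T , M∈ , _ , refl =
    let x , x∈ = meeting L∈ M∈
        x∈L , x∈M = Subset.x∈p∩q⁻ L M x∈
    in x Fin.↑ˡ _ , Subset.x∈p∩q⁺ (∈-++ˡ S x∈L , ∈-++ˡ T x∈M)

  size-planeFamily : ∀ s m t → size (planeFamily s m t) ≡ (p * p + p + 1) * m ^ s
  size-planeFamily s m t = trans (length-⊗ lines (transversals s m t)) (cong₂ _*_
    (trans count (trans (cong (λ z → p * p + z) (ℕ.+-comm 1 p)) (sym (ℕ.+-assoc (p * p) p 1)))) (length-transversals s m t))

  Δ-planeFamily : ∀ s m t → length lines ≤ m → Δ (planeFamily s m t) ≤ suc p * m ^ s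
  Δ-planeFamily s m t ∣lines∣≤m = go (All.map⁺ (All.universal (deg-lines⊗transversals 𝒫 s m t ∣lines∣≤m) (allFin _)))
    where
    go : ∀ {ds} → All (_≤ suc p * m ^ s) ds → foldr _⊔_ 0 ds ≤ suc p * m ^ s
    go []         = z≤n
    go (d≤ ∷ ds≤) = ℕ.⊔-lub d≤ (go ds≤)

-- `n` is less than `(n / D + 1) * D`, and a quotient of at least 1 absorbs the added 1 at the price
-- of a factor 2.
n≤2D[n/D] : ∀ n D .{{_ : NonZero D}} → 1 ≤ n / D → n ≤ 2 * D * (n / D)
n≤2D[n/D] n D 1≤m = begin
  n                         ≤⟨ ℕ.≤-trans (ℕ.≤-reflexive (m≡m%n+[m/n]*n n D)) (ℕ.+-monoˡ-≤ (n / D * D) (ℕ.<⇒≤ (m%n<n n D))) ⟩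
  suc (n / D) * D           ≤⟨ ℕ.*-monoˡ-≤ D (ℕ.+-monoˡ-≤ (n / D) 1≤m) ⟩
  (n / D + n / D) * D       ≡⟨ cong (λ z → (n / D + z) * D) (ℕ.+-identityʳ (n / D)) ⟨
  (2 * (n / D)) * D         ≡⟨ trans (ℕ.*-assoc 2 (n / D) D) (trans (cong (2 *_) (ℕ.*-comm (n / D) D)) (sym (ℕ.*-assoc 2 D (n / D)))) ⟩
  2 * D * (n / D)           ∎
  where open ℕ.≤-Reasoning

^-distribʳ-* : ∀ s a b → (a * b) ^ s ≡ a ^ s * b ^ s
^-distribʳ-* zero    a b = refl
^-distribʳ-* (suc s) a b = trans (cong (a * b *_) (^-distribʳ-* s a b)) (ℕ.[m*n]*[o*p]≡[m*o]*[n*p] a b (a ^ s) (b ^ s))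

module LowerBound {p : ℕ} (𝒫 : Plane p) (C : ℚ) (C<threshold : C ℚ.< threshold p) (s : ℕ) where
  open Plane 𝒫

  -- For negative `C` an upper bound on `Δ` would estimate the diversity in the wrong direction.
  -- Raising `C` to 0 only lowers the diversity, and the result stays below the threshold, which is
  -- positive.
  C₊ : ℚ
  C₊ = C ℚ.⊔ ℚ.0ℚ

  instance
    C₊≥0 : ℚ.NonNegative C₊
    C₊≥0 = ℚ.nonNegative (ℚ.p≤q⊔p C ℚ.0ℚ)

  a b : ℕ
  a = p * p + p + 1
  b = suc p

  C₊<threshold : C₊ ℚ.< threshold p
  C₊<threshold with ℚ.⊔-sel C ℚ.0ℚ
  ... | inj₁ eq = subst (ℚ._< threshold p) (sym eq) C<threshold
  ... | inj₂ eq = subst (ℚ._< threshold p) (sym eq) (ℚ.positive⁻¹ (threshold p) {{ℚ.normalize-pos a b {{_}} {{a≢0}}}})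
    where
    a≢0 : NonZero a
    a≢0 = subst NonZero (ℕ.+-comm 1 (p * p + p)) _

  -- The guaranteed diversity per transversal: `a` lines contribute to the size and at most `b` of
  -- them to the bound on the degree.
  ε : ℚ
  ε = ℕ→ℚ a ℚ.- C₊ ℚ.* ℕ→ℚ b

  ε>0 : ℚ.0ℚ ℚ.< ε
  ε>0 = subst (ℚ._< ε) (ℚ.+-inverseʳ (C₊ ℚ.* ℕ→ℚ b)) (ℚ.+-monoˡ-< (ℚ.- (C₊ ℚ.* ℕ→ℚ b))
    (subst (C₊ ℚ.* ℕ→ℚ b ℚ.<_) (threshold-* p) (ℚ.*-monoˡ-<-pos (ℕ→ℚ b) {{ℕ→ℚ-positive b}} C₊<threshold)))

  d-planeFamily : ∀ m t → length lines ≤ m → ε ℚ.* ℕ→ℚ (m ^ s) ℚ.≤ d C (planeFamily 𝒫 s m t)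
  d-planeFamily m t ∣lines∣≤m = begin
    (A ℚ.- C₊ ℚ.* B) ℚ.* M                  ≡⟨ ℚ.*-distribʳ-+ M A (ℚ.- (C₊ ℚ.* B)) ⟩
    A ℚ.* M ℚ.+ (ℚ.- (C₊ ℚ.* B)) ℚ.* M      ≡⟨ cong₂ ℚ._+_ (trans (sym (ℕ→ℚ-homo-* a (m ^ s))) (cong ℕ→ℚ (sym (size-planeFamily 𝒫 s m t))))
                                                (sym (ℚ.neg-distribˡ-* (C₊ ℚ.* B) M)) ⟩
    ℕ→ℚ (size F) ℚ.- C₊ ℚ.* B ℚ.* M         ≤⟨ ℚ.+-monoʳ-≤ (ℕ→ℚ (size F)) (ℚ.neg-antimono-≤ (begin
      C ℚ.* ℕ→ℚ (Δ F)                         ≤⟨ ℚ.*-monoʳ-≤-nonNeg (ℕ→ℚ (Δ F)) {{ℕ→ℚ-nonNegative (Δ F)}} (ℚ.p≤p⊔q C ℚ.0ℚ) ⟩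
      C₊ ℚ.* ℕ→ℚ (Δ F)                        ≤⟨ ℚ.*-monoˡ-≤-nonNeg C₊ (ℕ→ℚ-mono-≤ (Δ-planeFamily 𝒫 s m t ∣lines∣≤m)) ⟩
      C₊ ℚ.* ℕ→ℚ (b * m ^ s)                  ≡⟨ cong (C₊ ℚ.*_) (ℕ→ℚ-homo-* b (m ^ s)) ⟩
      C₊ ℚ.* (B ℚ.* M)                        ≡⟨ ℚ.*-assoc C₊ B M ⟨
      C₊ ℚ.* B ℚ.* M                          ∎)) ⟩
    d C F                                   ∎
    where
    open ℚ.≤-Reasoning
    F = planeFamily 𝒫 s m t
    A = ℕ→ℚ a
    B = ℕ→ℚ b
    M = ℕ→ℚ (m ^ s)

  -- The `n` points are divided into `s + 1` shares: `s` blocks, and one share with room for the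
  -- plane. `K` is the loss in passing from n ^ s to m ^ s, since `n` is at most `2 * D` times the
  -- block length.
  D K : ℕ
  D = suc s
  K = (2 * D) ^ s

  instance
    K≢0 : NonZero K
    K≢0 = ℕ.m^n≢0 (2 * D) s
    K>0 : ℚ.Positive (ℕ→ℚ K)
    K>0 = ℕ→ℚ-positive K
    Kℚ≢0 : ℚ.NonZero (ℕ→ℚ K)
    Kℚ≢0 = ℚ.pos⇒nonZero (ℕ→ℚ K)

  lowerBound : DIsBigΩ C (suc p + s) s
  lowerBound = ε ℚ.* ℚ.1/ (ℕ→ℚ K) , c>0 , N , witness
    where
    -- Forces blocks longer than `order + length lines`: they are nonempty, the plane fits into one
    -- share, and the degree bound applies.
    N = suc (order + length lines) * D

    c>0 : ℚ.0ℚ ℚ.< ε ℚ.* ℚ.1/ (ℕ→ℚ K)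
    c>0 = ℚ.positive⁻¹ _ {{ℚ.pos*pos⇒pos ε {{ℚ.positive ε>0}} (ℚ.1/ (ℕ→ℚ K)) {{ℚ.1/pos⇒pos (ℕ→ℚ K)}}}}

    witness : ∀ n → N ≤ n → Σ (Family n (suc p + s)) λ F →
              Intersecting F × ε ℚ.* ℚ.1/ (ℕ→ℚ K) ℚ.* ℕ→ℚ (n ^ s) ℚ.≤ d C F
    witness n N≤n = subst (λ n′ → Σ (Family n′ (suc p + s)) λ F →
        Intersecting F × ε ℚ.* ℚ.1/ (ℕ→ℚ K) ℚ.* ℕ→ℚ (n ^ s) ℚ.≤ d C F) order+dim≡n
      (planeFamily 𝒫 s m t , (λ {A} {B} → planeFamily-intersecting 𝒫 s m t {A} {B}) , estimate)
      where
      m t : ℕ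
      m = n / D
      t = n ∸ (order + s * m)

      large : suc (order + length lines) ≤ m
      large = ℕ.≤-trans (ℕ.≤-reflexive (sym (m*n/n≡m (suc (order + length lines)) D))) (/-monoˡ-≤ D N≤n)

      order≤m : order ≤ m
      order≤m = ℕ.≤-trans (ℕ.m≤n⇒m≤1+n (ℕ.m≤m+n order (length lines))) large

      ∣lines∣≤m : length lines ≤ m
      ∣lines∣≤m = ℕ.≤-trans (ℕ.m≤n⇒m≤1+n (ℕ.m≤n+m (length lines) order)) large

      order+dim≡n : order + dim s m t ≡ n
      order+dim≡n = trans (cong (order ℕ.+_) (dim≡ s m t)) (trans (sym (ℕ.+-assoc order (s * m) t)) (ℕ.m+[n∸m]≡n
        (ℕ.≤-trans (ℕ.+-monoˡ-≤ (s * m) order≤m) (ℕ.≤-trans (ℕ.≤-reflexive (ℕ.*-comm D m)) (m/n*n≤m n D)))))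

      n^s≤ : n ^ s ≤ K * m ^ s
      n^s≤ = ℕ.≤-trans (ℕ.^-monoˡ-≤ s (n≤2D[n/D] n D (ℕ.≤-trans (s≤s z≤n) large)))
               (ℕ.≤-reflexive (^-distribʳ-* s (2 * D) m))

      estimate : ε ℚ.* ℚ.1/ (ℕ→ℚ K) ℚ.* ℕ→ℚ (n ^ s) ℚ.≤ d C (planeFamily 𝒫 s m t)
      estimate = begin
        ε ℚ.* ℚ.1/ (ℕ→ℚ K) ℚ.* ℕ→ℚ (n ^ s)               ≤⟨ ℚ.*-monoˡ-≤-nonNeg (ε ℚ.* ℚ.1/ (ℕ→ℚ K)) {{ℚ.nonNegative (ℚ.<⇒≤ c>0)}} (ℕ→ℚ-mono-≤ n^s≤) ⟩
        ε ℚ.* ℚ.1/ (ℕ→ℚ K) ℚ.* ℕ→ℚ (K * m ^ s)           ≡⟨ cong (ε ℚ.* ℚ.1/ (ℕ→ℚ K) ℚ.*_) (ℕ→ℚ-homo-* K (m ^ s)) ⟩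
        ε ℚ.* ℚ.1/ (ℕ→ℚ K) ℚ.* (ℕ→ℚ K ℚ.* ℕ→ℚ (m ^ s))   ≡⟨ ℚ.*-assoc (ε ℚ.* ℚ.1/ (ℕ→ℚ K)) (ℕ→ℚ K) (ℕ→ℚ (m ^ s)) ⟨
        ε ℚ.* ℚ.1/ (ℕ→ℚ K) ℚ.* ℕ→ℚ K ℚ.* ℕ→ℚ (m ^ s)     ≡⟨ cong (ℚ._* ℕ→ℚ (m ^ s)) (trans (ℚ.*-assoc ε (ℚ.1/ (ℕ→ℚ K)) (ℕ→ℚ K))
                                                             (trans (cong (ε ℚ.*_) (ℚ.*-inverseˡ (ℕ→ℚ K))) (ℚ.*-identityʳ ε))) ⟩
        ε ℚ.* ℕ→ℚ (m ^ s)                                ≤⟨ d-planeFamily m t ∣lines∣≤m ⟩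
        d C (planeFamily 𝒫 s m t)                        ∎
        where open ℚ.≤-Reasoning

primePower⇒plane : ∀ {q} → IsPrimePower q → Plane q
primePower⇒plane (p , k , pr , 1≤k , refl) = PlaneOf.plane (fromℕ< (ℕ.<-trans (s≤s z≤n) 1<q)) planarTernary
  where open GaloisField p k pr 1≤k

theorem3 : (r : ℕ) → 3 ≤ r → (C : ℚ) →
    ((q : ℕ) → 1 ≤ q → q < r → threshold q ℚ.≤ C → DIsBigO C r (r ∸ q ∸ 1))
    × ((p : ℕ) → IsPrimePower p → p < r → C ℚ.< threshold p → DIsBigΩ C r (r ∸ p ∸ 1))
theorem3 r _ C =
  (λ q _ q<r → upperBound r C q q<r) ,
  (λ p p-primePower p<r C<threshold → subst (λ r′ → DIsBigΩ C r′ (r ∸ p ∸ 1)) (exponent p p<r)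
    (LowerBound.lowerBound (primePower⇒plane p-primePower) C C<threshold (r ∸ p ∸ 1)))
  where
  exponent : ∀ p → p < r → suc p + (r ∸ p ∸ 1) ≡ r
  exponent p p<r = trans (cong (λ z → suc p + z) (trans (ℕ.∸-+-assoc r p 1) (cong (r ∸_) (ℕ.+-comm p 1)))) (ℕ.m+[n∸m]≡n p<r)
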